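{- For every integer $r \ge 3$, there exist infinitely many families $\mathcal{F}$ of graphs with $|\mathcal{F}| = 3$ such that the ratio $\frac{\mathrm{sat}(n, K_r, \mathcal{F})}{n}$ does not tend to a limit as $n \to \infty$.
   Context: For a family of graphs $\mathcal{F}$, a graph $G$ is $\mathcal{F}$-saturated if $G$ contains no copy of any graph in $\mathcal{F}$, but adding any edge to $G$ creates a copy of some graph in $\mathcal{F}$. $\mathrm{sat}(n, K_r, \mathcal{F})$ is the minimum number of copies of the complete graph $K_r$ in an $n$-vertex $\mathcal{F}$-saturated graph. -}

module Defs where

open import Data.Nat using (ℕ; zero; suc; _≤_)
open import Data.Bool using (Bool; true; false; _∧_)
open import Data.Fin using (Fin)
open import Data.Fin.Subset using (Subset; inside; outside; _∈_; ∣_∣)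
open import Data.Fin.Subset.Properties using (_∈?_)
open import Data.Fin.Properties using (all?)
open import Data.Vec using ([]; _∷_)
open import Data.List using (List; []; _∷_; map; _++_; filter; length)
open import Data.Product using (Σ; Σ-syntax; ∃; _×_; _,_)
open import Data.Sum using (_⊎_)
open import Data.Integer using (+_)
open import Data.Rational using (ℚ; _/_; _-_; _<_; 0ℚ) renaming (∣_∣ to abs)
open import Relation.Nullary using (¬_; Dec; yes; no)
open import Relation.Nullary.Decidable using (_×-dec_; _→-dec_; ⌊_⌋)
open import Relation.Binary.PropositionalEquality using (_≡_; _≢_)
open import Function.Definitions using (Injective)
open import Data.Nat.Properties using (_≟_)
import Data.Fin.Properties as FinP

record SimpleGraph (n : ℕ) : Set where
  field
    adj    : Fin n → Fin n → Bool
    sym    : ∀ x y → adj x y ≡ adj y x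
    irrefl : ∀ x → adj x x ≡ false

open SimpleGraph public

Adj : ∀ {n} → SimpleGraph n → Fin n → Fin n → Set
Adj G x y = adj G x y ≡ true

record Graph : Set where
  constructor graph
  field
    order : ℕ
    gr    : SimpleGraph order

open Graph public

Iso : Graph → Graph → Set
Iso (graph m G) (graph n H) =
  Σ (Fin m → Fin n) λ f → Σ (Fin n → Fin m) λ g →
    (∀ x → g (f x) ≡ x) × (∀ y → f (g y) ≡ y) ×
    (∀ x y → adj H (f x) (f y) ≡ adj G x y)

CopyIn : (H : Graph) {n : ℕ} → (Fin n → Fin n → Set) → Set
CopyIn (graph m H) {n} E =
  Σ (Fin m → Fin n) λ f → Injective _≡_ _≡_ f × (∀ x y → Adj H x y → E (f x) (f y))

record Family3 : Set where
  field
    member   : Fin 3 → Graph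
    distinct : ∀ i j → i ≢ j → ¬ Iso (member i) (member j)

open Family3 public

SameFamily : Family3 → Family3 → Set
SameFamily F F′ =
  (∀ i → ∃ λ j → Iso (member F i) (member F′ j)) ×
  (∀ j → ∃ λ i → Iso (member F′ j) (member F i))

ContainsFam : Family3 → ∀ {n} → (Fin n → Fin n → Set) → Set
ContainsFam F E = ∃ λ i → CopyIn (member F i) E

AddEdge : ∀ {n} → SimpleGraph n → Fin n → Fin n → Fin n → Fin n → Set
AddEdge G u v x y = Adj G x y ⊎ ((x ≡ u × y ≡ v) ⊎ (x ≡ v × y ≡ u))

Saturated : Family3 → ∀ {n} → SimpleGraph n → Set
Saturated F G =
  ¬ ContainsFam F (Adj G) ×
  (∀ u v → u ≢ v → ¬ Adj G u v → ContainsFam F (AddEdge G u v))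

allSubsets : (n : ℕ) → List (Subset n)
allSubsets zero    = [] ∷ []
allSubsets (suc n) = map (outside ∷_) (allSubsets n) ++ map (inside ∷_) (allSubsets n)

IsClique : ∀ {n} → SimpleGraph n → Subset n → Set
IsClique G S = ∀ x y → x ∈ S → y ∈ S → x ≢ y → Adj G x y

isClique? : ∀ {n} (G : SimpleGraph n) (S : Subset n) → Dec (IsClique G S)
isClique? G S =
  all? λ x → all? λ y →
    (x ∈? S) →-dec ((y ∈? S) →-dec
      ((Relation.Nullary.Decidable.¬? (x FinP.≟ y)) →-dec (Data.Bool._≟_ (adj G x y) true)))
  where import Data.Bool
        import Relation.Nullary.Decidable

copiesK : ∀ {n} → SimpleGraph n → ℕ → ℕ
copiesK {n} G r =
  length (filter (λ S → (∣ S ∣ ≟ r) ×-dec isClique? G S) (allSubsets n))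

IsSat : Family3 → (r n s : ℕ) → Set
IsSat F r n s =
  (Σ (SimpleGraph n) λ G → Saturated F G × copiesK G r ≡ s) ×
  (∀ (G : SimpleGraph n) → Saturated F G → s ≤ copiesK G r)

-- The ratio sequence s(n)/n, indexed from n = 1 (k ↦ s(k+1)/(k+1)).

ratio : (ℕ → ℕ) → ℕ → ℚ
ratio s k = (+ s (suc k)) / suc k

-- A rational sequence converges (to a real number) iff it is Cauchy.
Cauchy : (ℕ → ℚ) → Set
Cauchy a = ∀ (ε : ℚ) → 0ℚ < ε → ∃ λ N → ∀ m n → N ≤ m → N ≤ n → abs (a m - a n) < ε

{-# OPTIONS --safe #-}
module Submission where

-- Let q = p + r with p large compared to r, and forbid the three chains listed at `sizes`.
--
-- If q divides n, the disjoint union of copies of K_q is saturated, and each of its vertices lies in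
-- c₁ = C(q-1, r-1) copies of K_r; so sat(n, K_r, F) ≤ (c₁ / r) n.
--
-- In any saturated graph the q-cliques are pairwise disjoint. If q does not divide n, some vertex is
-- in no q-clique ("uncovered"), and the slope is strictly larger:
--  * adding an edge between an uncovered vertex and a q-clique Q must create a forbidden graph, which
--    forces an r-clique meeting Q but contained in no q-clique, so every Q carries an extra K_r;
--  * two non-adjacent uncovered vertices have a common p-clique in their neighbourhoods. Call an
--    uncovered vertex heavy if it lies in at least 6 c₁ copies of K_r and light otherwise. A maximal
--    clique of light vertices sees only boundedly many vertices through copies of K_r, and all but
--    boundedly many light vertices are joined to a p-clique among these, which yields C(p, r-1)
--    private copies of K_r for each, and r C(p, r-1) ≥ 2 c₁.

open import Defs hiding (sym)
open import Data.Bool using (Bool; true; false; not; _∧_; _∨_)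
import Data.Bool.Properties as Bool
open import Data.Empty using (⊥-elim) renaming (⊥ to Absurd)
open import Data.Fin using (Fin; zero; suc; splitAt; _↑ˡ_; _↑ʳ_; combine; remQuot)
open import Data.Fin.Properties using (any?; all?; ¬∀⟶∃¬; injective⇒≤; splitAt-↑ˡ; splitAt-↑ʳ; splitAt⁻¹-↑ˡ; splitAt⁻¹-↑ʳ; ↑ˡ-injective; ↑ʳ-injective; remQuot-combine; combine-remQuot; combine-injective; combine-injectiveʳ) renaming (_≟_ to _≟ᶠ_; suc-injective to suc-injectiveᶠ)
open import Data.Fin.Subset
open import Data.Fin.Subset.Properties
import Data.Integer as ℤ
import Data.Integer.Properties as ℤ
open import Data.List using (List; []; _∷_; map; _++_; filter; length; allFin)
open import Data.List.Membership.Propositional using () renaming (_∈_ to _∈ˡ_)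
open import Data.List.Membership.Propositional.Properties using (∈-++⁺ˡ; ∈-++⁺ʳ; ∈-map⁺; ∈-allFin)
open import Data.List.Properties using (map-tabulate)
open import Data.List.Relation.Unary.Any using () renaming (here to hereˡ; there to thereˡ)
open import Data.Nat hiding (∣_-_∣)
open import Data.Nat.Combinatorics using (_C_; nCn≡1; nC1≡n; nCk≡nC[n∸k]; nCk+nC[k+1]≡[n+1]C[k+1]; k>n⇒nCk≡0)
open import Data.Nat.Divisibility using (_∣_; divides; ∣m+n∣m⇒∣n; ∣1⇒≡1; n∣m*n)
open import Data.Nat.Induction using (<-rec)
open import Data.Nat.ListAction using (sum)
open import Data.Nat.Properties
open import Algebra.Properties.CommutativeSemigroup +-commutativeSemigroup using () renaming (interchange to +-interchange)
open import Data.Nat.Solver using (module +-*-Solver)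
open import Data.Product using (Σ; ∃; _×_; _,_; proj₁; proj₂; uncurry)
open import Data.Rational as ℚ using (0ℚ)
import Data.Rational.Properties as ℚ
open import Data.Rational.Unnormalised as ℚᵘ using (mkℚᵘ)
import Data.Rational.Unnormalised.Properties as ℚᵘ
open import Data.Sum using (_⊎_; inj₁; inj₂; [_,_]′)
open import Data.Vec using ([]; _∷_; here; there; lookup; tabulate)
open import Data.Vec.Properties using (lookup∘tabulate; []=⇒lookup; lookup⇒[]=)
open import Function using (_∘_; id; const)
open import Function.Bundles using (mk⇔)
open import Function.Definitions using (Injective)
open import Relation.Binary.PropositionalEquality
open import Relation.Nullary
open import Relation.Nullary.Decidable using (_×-dec_; _→-dec_; _⊎-dec_; ¬?; map′; decidable-stable; does-⇔; dec-true; dec-false)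
open import Relation.Unary using (Pred; Decidable)

-- Indicators and finite sums

-- The decisive lengths are n = kq and n = kq + 1. Blocks K_q with one cheap leftover vertex would
-- have the same slope c₁ / r in both cases, so it is not enough that uncovered vertices are
-- expensive: a single one must make every q-clique pay. The first two forbidden graphs keep
-- q-cliques apart: an overlap in at least r vertices produces the first, a smaller nonempty one the
-- second. The third makes disjoint copies of K_q saturated; an edge added at an uncovered vertex
-- cannot serve as its bridge, since both ends of the bridge lie in q-cliques. The extra copies of
-- K_r are charged three times, by covered, heavy and light vertices. The factors 6 and 2 are chosen
-- for this: 1/6 + 1/2 is less than 1, so after all uncovered vertices are paid for, a share of the
-- extra copies remains for the covered ones. The condition p + 1 ≥ 3 (r - 1)² suffices for r C(p,
-- r-1) ≥ 2 c₁, and the infinitely many such p give infinitely many families.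

⟦_⟧ : ∀ {a} {P : Set a} → Dec P → ℕ
⟦ true because _ ⟧ = 1
⟦ false because _ ⟧ = 0

⟦⟧-yes : ∀ {a} {P : Set a} (d : Dec P) → P → ⟦ d ⟧ ≡ 1
⟦⟧-yes (yes _) p = refl
⟦⟧-yes (no ¬p) p = ⊥-elim (¬p p)

⟦⟧-no : ∀ {a} {P : Set a} (d : Dec P) → ¬ P → ⟦ d ⟧ ≡ 0
⟦⟧-no (yes p) ¬p = ⊥-elim (¬p p)
⟦⟧-no (no _)  ¬p = refl

⟦⟧-mono : ∀ {a b} {P : Set a} {Q : Set b} (d : Dec P) (e : Dec Q) → (P → Q) → ⟦ d ⟧ ≤ ⟦ e ⟧
⟦⟧-mono (yes p) e f = ≤-reflexive (sym (⟦⟧-yes e (f p)))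
⟦⟧-mono (no _)  e f = z≤n

⟦⟧-cong : ∀ {a b} {P : Set a} {Q : Set b} (d : Dec P) (e : Dec Q) → (P → Q) → (Q → P) → ⟦ d ⟧ ≡ ⟦ e ⟧
⟦⟧-cong d e f g = ≤-antisym (⟦⟧-mono d e f) (⟦⟧-mono e d g)

⟦⟧-× : ∀ {a b} {P : Set a} {Q : Set b} (d : Dec P) (e : Dec Q) → ⟦ d ×-dec e ⟧ ≡ ⟦ d ⟧ * ⟦ e ⟧
⟦⟧-× (yes _) (yes _) = refl
⟦⟧-× (yes _) (no _)  = refl
⟦⟧-× (no _)  e       = refl

module _ {a} {A : Set a} where

  ∑ : List A → (A → ℕ) → ℕ
  ∑ []       f = 0
  ∑ (x ∷ xs) f = f x + ∑ xs f

  ∑-mono : ∀ xs {f g : A → ℕ} → (∀ x → f x ≤ g x) → ∑ xs f ≤ ∑ xs g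
  ∑-mono []       h = z≤n
  ∑-mono (x ∷ xs) h = +-mono-≤ (h x) (∑-mono xs h)

  ∑-cong : ∀ xs {f g : A → ℕ} → (∀ x → f x ≡ g x) → ∑ xs f ≡ ∑ xs g
  ∑-cong []       h = refl
  ∑-cong (x ∷ xs) h = cong₂ _+_ (h x) (∑-cong xs h)

  ∑-+ : ∀ xs (f g : A → ℕ) → ∑ xs (λ x → f x + g x) ≡ ∑ xs f + ∑ xs g
  ∑-+ []       f g = refl
  ∑-+ (x ∷ xs) f g rewrite ∑-+ xs f g = +-interchange (f x) (g x) (∑ xs f) (∑ xs g)

  ∑-* : ∀ xs c (f : A → ℕ) → ∑ xs (λ x → c * f x) ≡ c * ∑ xs f
  ∑-* []       c f = sym (*-zeroʳ c)
  ∑-* (x ∷ xs) c f rewrite ∑-* xs c f = sym (*-distribˡ-+ c (f x) (∑ xs f))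

  ∑-zero : ∀ xs {f : A → ℕ} → (∀ x → f x ≡ 0) → ∑ xs f ≡ 0
  ∑-zero []       h = refl
  ∑-zero (x ∷ xs) h rewrite h x = ∑-zero xs h

  ∑-++ : ∀ xs ys (f : A → ℕ) → ∑ (xs ++ ys) f ≡ ∑ xs f + ∑ ys f
  ∑-++ []       ys f = refl
  ∑-++ (x ∷ xs) ys f rewrite ∑-++ xs ys f = sym (+-assoc (f x) (∑ xs f) (∑ ys f))

  ∑-term : ∀ {x xs} (f : A → ℕ) → x ∈ˡ xs → f x ≤ ∑ xs f
  ∑-term f (hereˡ refl)         = m≤m+n _ _
  ∑-term f (thereˡ {x = y} x∈) = ≤-trans (∑-term f x∈) (m≤n+m _ (f y))

  length-filter : ∀ {p} {P : Pred A p} (P? : Decidable P) xs → length (filter P? xs) ≡ ∑ xs (λ x → ⟦ P? x ⟧)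
  length-filter P? []       = refl
  length-filter P? (x ∷ xs) with P? x
  ... | true because _  = cong suc (length-filter P? xs)
  ... | false because _ = length-filter P? xs

∑-map : ∀ {a b} {A : Set a} {B : Set b} (g : A → B) xs (f : B → ℕ) → ∑ (map g xs) f ≡ ∑ xs (f ∘ g)
∑-map g []       f = refl
∑-map g (x ∷ xs) f = cong (f (g x) +_) (∑-map g xs f)

∑-swap : ∀ {a b} {A : Set a} {B : Set b} xs ys (f : A → B → ℕ) →
         ∑ xs (λ x → ∑ ys (f x)) ≡ ∑ ys (λ y → ∑ xs (λ x → f x y))
∑-swap []       ys f = sym (∑-zero ys (λ _ → refl))
∑-swap (x ∷ xs) ys f rewrite ∑-swap xs ys f = sym (∑-+ ys (f x) (λ y → ∑ xs (λ z → f z y)))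

∑-allFin : ∀ {n} (f : Fin (suc n) → ℕ) → ∑ (allFin (suc n)) f ≡ f zero + ∑ (allFin n) (f ∘ suc)
∑-allFin {n} f = cong (f zero +_) (trans (cong (λ xs → ∑ xs f) (sym (map-tabulate id suc))) (∑-map suc (allFin n) f))

∑-allSubsets : ∀ {n} (f : Subset (suc n) → ℕ) →
  ∑ (allSubsets (suc n)) f ≡ ∑ (allSubsets n) (f ∘ (outside ∷_)) + ∑ (allSubsets n) (f ∘ (inside ∷_))
∑-allSubsets {n} f = trans (∑-++ (map (outside ∷_) (allSubsets n)) _ f)
  (cong₂ _+_ (∑-map (outside ∷_) (allSubsets n) f) (∑-map (inside ∷_) (allSubsets n) f))

∈-allSubsets : ∀ {n} (S : Subset n) → S ∈ˡ allSubsets n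
∈-allSubsets []            = hereˡ refl
∈-allSubsets (outside ∷ S) = ∈-++⁺ˡ (∈-map⁺ (outside ∷_) (∈-allSubsets S))
∈-allSubsets (inside ∷ S)  = ∈-++⁺ʳ _ (∈-map⁺ (inside ∷_) (∈-allSubsets S))

∑-∈ : ∀ {n} (p : Subset n) → ∑ (allFin n) (λ x → ⟦ x ∈? p ⟧) ≡ ∣ p ∣
∑-∈ []      = refl
∑-∈ {suc n} (s ∷ p) = trans (∑-allFin (λ x → ⟦ x ∈? s ∷ p ⟧))
  (trans (cong (⟦ zero ∈? s ∷ p ⟧ +_) (trans (∑-cong (allFin n) step) (∑-∈ p))) (head s))
  where
  step : ∀ x → ⟦ suc x ∈? s ∷ p ⟧ ≡ ⟦ x ∈? p ⟧
  step x = ⟦⟧-cong (suc x ∈? s ∷ p) (x ∈? p) drop-there there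
  head : ∀ s → ⟦ zero ∈? s ∷ p ⟧ + ∣ p ∣ ≡ ∣ s ∷ p ∣
  head inside  = refl
  head outside = refl

∑-one : ∀ n → ∑ (allFin n) (λ _ → 1) ≡ n
∑-one zero    = refl
∑-one (suc n) = trans (∑-allFin {n} (λ _ → 1)) (cong suc (∑-one n))

∑-≤∣∣ : ∀ {n a} {P : Fin n → Set a} (P? : ∀ x → Dec (P x)) (p : Subset n) →
        (∀ x → P x → x ∈ p) → ∑ (allFin n) (λ x → ⟦ P? x ⟧) ≤ ∣ p ∣
∑-≤∣∣ {n} P? p h = ≤-trans (∑-mono (allFin n) (λ x → ⟦⟧-mono (P? x) (x ∈? p) (h x))) (≤-reflexive (∑-∈ p))

-- Cardinalities of subsets

∣p∣≤∣p─q∣+∣q∣ : ∀ {n} (p q : Subset n) → ∣ p ∣ ≤ ∣ p ─ q ∣ + ∣ q ∣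
∣p∣≤∣p─q∣+∣q∣ []            []            = z≤n
∣p∣≤∣p─q∣+∣q∣ (outside ∷ p) (outside ∷ q) = ∣p∣≤∣p─q∣+∣q∣ p q
∣p∣≤∣p─q∣+∣q∣ (inside ∷ p)  (outside ∷ q) = s≤s (∣p∣≤∣p─q∣+∣q∣ p q)
∣p∣≤∣p─q∣+∣q∣ (outside ∷ p) (inside ∷ q)  = ≤-trans (∣p∣≤∣p─q∣+∣q∣ p q) (+-monoʳ-≤ ∣ p ─ q ∣ (n≤1+n _))
∣p∣≤∣p─q∣+∣q∣ (inside ∷ p)  (inside ∷ q)  = ≤-trans (s≤s (∣p∣≤∣p─q∣+∣q∣ p q)) (≤-reflexive (sym (+-suc ∣ p ─ q ∣ ∣ q ∣)))

∣p∣≤1+∣p-x∣ : ∀ {n} (p : Subset n) x → ∣ p ∣ ≤ suc ∣ p - x ∣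
∣p∣≤1+∣p-x∣ p x = ≤-trans (∣p∣≤∣p─q∣+∣q∣ p ⁅ x ⁆)
  (≤-reflexive (trans (cong (∣ p - x ∣ +_) (∣⁅x⁆∣≡1 x)) (+-comm ∣ p - x ∣ 1)))

∣p∪q∣≤∣p∣+∣q∣ : ∀ {n} (p q : Subset n) → ∣ p ∪ q ∣ ≤ ∣ p ∣ + ∣ q ∣
∣p∪q∣≤∣p∣+∣q∣ []            []            = z≤n
∣p∪q∣≤∣p∣+∣q∣ (outside ∷ p) (outside ∷ q) = ∣p∪q∣≤∣p∣+∣q∣ p q
∣p∪q∣≤∣p∣+∣q∣ (inside ∷ p)  (outside ∷ q) = s≤s (∣p∪q∣≤∣p∣+∣q∣ p q)
∣p∪q∣≤∣p∣+∣q∣ (outside ∷ p) (inside ∷ q)  = ≤-trans (s≤s (∣p∪q∣≤∣p∣+∣q∣ p q)) (≤-reflexive (sym (+-suc ∣ p ∣ ∣ q ∣)))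
∣p∪q∣≤∣p∣+∣q∣ (inside ∷ p)  (inside ∷ q)  = s≤s (≤-trans (∣p∪q∣≤∣p∣+∣q∣ p q) (+-monoʳ-≤ ∣ p ∣ (n≤1+n _)))

x∈p─q⇒x∉q : ∀ {n x} (p q : Subset n) → x ∈ p ─ q → x ∉ q
x∈p─q⇒x∉q (s ∷ p) (inside ∷ q)  (there m) (there k) = x∈p─q⇒x∉q p q m k
x∈p─q⇒x∉q (s ∷ p) (outside ∷ q) (there m) (there k) = x∈p─q⇒x∉q p q m k

x∈p-y⇒x≢y : ∀ {n x y} (p : Subset n) → x ∈ p - y → x ≢ y
x∈p-y⇒x≢y p m refl = x∈p─q⇒x∉q p _ m (x∈⁅x⁆ _)

∣p∣>0⇒Nonempty : ∀ {n} (p : Subset n) → 1 ≤ ∣ p ∣ → Nonempty p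
∣p∣>0⇒Nonempty {n} p h with nonempty? p
... | yes e = e
... | no ¬e = ⊥-elim (1+n≰n (≤-trans h (≤-reflexive (trans (cong ∣_∣ (Empty-unique ¬e)) (∣⊥∣≡0 n)))))

x∈p⇒∣p∣>0 : ∀ {n x} (p : Subset n) → x ∈ p → 1 ≤ ∣ p ∣
x∈p⇒∣p∣>0 p x∈ = ≤-trans (s≤s z≤n) (x∈p⇒∣p-x∣<∣p∣ x∈)

-- Supplies cliques of a prescribed size through prescribed vertices. An element of A outside S is
-- skipped whenever the remaining part of A still has m elements, and taken otherwise.
intermediate : ∀ {n} (S A : Subset n) m → S ⊆ A → ∣ S ∣ ≤ m → m ≤ ∣ A ∣ →
               ∃ λ B → S ⊆ B × B ⊆ A × ∣ B ∣ ≡ m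
intermediate [] [] zero S⊆A lo hi = [] , id , id , refl
intermediate (outside ∷ S) (outside ∷ A) m S⊆A lo hi =
  let B , i , j , e = intermediate S A m (drop-∷-⊆ S⊆A) lo hi in outside ∷ B , s⊆s i , s⊆s j , e
intermediate (inside ∷ S) (outside ∷ A) m S⊆A lo hi with () ← S⊆A here
intermediate (inside ∷ S) (inside ∷ A) (suc m) S⊆A (s≤s lo) (s≤s hi) =
  let B , i , j , e = intermediate S A m (drop-∷-⊆ S⊆A) lo hi in inside ∷ B , s⊆s i , s⊆s j , cong suc e
intermediate (outside ∷ S) (inside ∷ A) m S⊆A lo hi with m ≤? ∣ A ∣
... | yes m≤ = let B , i , j , e = intermediate S A m (drop-∷-⊆ S⊆A) lo m≤ in outside ∷ B , s⊆s i , out⊆ j , e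
intermediate (outside ∷ S) (inside ∷ A) zero S⊆A lo hi | no m≰ = ⊥-elim (m≰ z≤n)
intermediate (outside ∷ S) (inside ∷ A) (suc m) S⊆A lo (s≤s hi) | no m≰ =
  let B , i , j , e = intermediate S A m (drop-∷-⊆ S⊆A)
                        (≤-trans (p⊆q⇒∣p∣≤∣q∣ (drop-∷-⊆ S⊆A)) (s≤s⁻¹ (≰⇒> m≰))) hi
  in inside ∷ B , out⊆ i , s⊆s j , cong suc e

injection⇒≤∣∣ : ∀ {n} s (g : Fin s → Fin n) (S : Subset n) → Injective _≡_ _≡_ g → (∀ i → g i ∈ S) → s ≤ ∣ S ∣
injection⇒≤∣∣ zero    g S inj h = z≤n
injection⇒≤∣∣ (suc s) g S inj h = ≤-trans
  (s≤s (injection⇒≤∣∣ s (g ∘ suc) (S - g zero) (suc-injectiveᶠ ∘ inj)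
     (λ i → x∈p∧x≢y⇒x∈p-y (h (suc i)) (λ e → 0≢suc (inj (sym e))))))
  (x∈p⇒∣p-x∣<∣p∣ (h zero))
  where
  0≢suc : ∀ {m} {i : Fin m} → Fin.zero ≢ suc i
  0≢suc ()

≤∣∣⇒injection : ∀ {n} s (S : Subset n) → s ≤ ∣ S ∣ →
                ∃ λ (g : Fin s → Fin n) → Injective _≡_ _≡_ g × (∀ i → g i ∈ S)
≤∣∣⇒injection zero    S h = (λ ()) , (λ {}) , λ ()
≤∣∣⇒injection {n} (suc s) S h = g′ , inj′ , mem
  where
  ne = ∣p∣>0⇒Nonempty S (≤-trans (s≤s z≤n) h)
  x = proj₁ ne
  rec = ≤∣∣⇒injection s (S - x) (s≤s⁻¹ (≤-trans h (∣p∣≤1+∣p-x∣ S x)))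
  g = proj₁ rec
  g∈ = proj₂ (proj₂ rec)
  g′ : Fin (suc s) → Fin n
  g′ zero    = x
  g′ (suc i) = g i
  inj′ : Injective _≡_ _≡_ g′
  inj′ {zero}  {zero}  e = refl
  inj′ {zero}  {suc j} e = ⊥-elim (x∈p-y⇒x≢y S (g∈ j) (sym e))
  inj′ {suc i} {zero}  e = ⊥-elim (x∈p-y⇒x≢y S (g∈ i) e)
  inj′ {suc i} {suc j} e = cong suc (proj₁ (proj₂ rec) e)
  mem : ∀ i → g′ i ∈ S
  mem zero    = proj₂ ne
  mem (suc i) = p─q⊆p S ⁅ x ⁆ (g∈ i)

-- Binomial counts of subsets

nC0≡1 : ∀ n → n C 0 ≡ 1
nC0≡1 n = trans (nCk≡nC[n∸k] {0} {n} z≤n) (nCn≡1 n)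

in⊈out : ∀ {n} {S Q : Subset n} → ¬ (inside ∷ S ⊆ outside ∷ Q)
in⊈out i with () ← i here

countSubsets : ∀ {n} (Q : Subset n) k → ∑ (allSubsets n) (λ S → ⟦ (S ⊆? Q) ×-dec (∣ S ∣ ≟ k) ⟧) ≡ ∣ Q ∣ C k
countSubsets []            zero    = refl
countSubsets []            (suc k) = sym (k>n⇒nCk≡0 {0} {suc k} (s≤s z≤n))
countSubsets {suc n} (outside ∷ Q) k = trans (∑-allSubsets (λ S → ⟦ (S ⊆? outside ∷ Q) ×-dec (∣ S ∣ ≟ k) ⟧))
  (trans (cong₂ _+_
    (trans (∑-cong (allSubsets n) (λ S → ⟦⟧-cong ((outside ∷ S ⊆? outside ∷ Q) ×-dec (∣ S ∣ ≟ k)) ((S ⊆? Q) ×-dec (∣ S ∣ ≟ k))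
              (λ (i , e) → (λ {x} → drop-∷-⊆ i {x}) , e) (λ (i , e) → (λ {x} → s⊆s i {x}) , e)))
           (countSubsets Q k))
    (∑-zero (allSubsets n) (λ S → ⟦⟧-no ((inside ∷ S ⊆? outside ∷ Q) ×-dec (suc ∣ S ∣ ≟ k)) (λ (i , _) → in⊈out i))))
   (+-identityʳ _))
countSubsets {suc n} (inside ∷ Q) zero = trans (∑-allSubsets (λ S → ⟦ (S ⊆? inside ∷ Q) ×-dec (∣ S ∣ ≟ 0) ⟧))
  (trans (cong₂ _+_
    (trans (∑-cong (allSubsets n) (λ S → ⟦⟧-cong ((outside ∷ S ⊆? inside ∷ Q) ×-dec (∣ S ∣ ≟ 0)) ((S ⊆? Q) ×-dec (∣ S ∣ ≟ 0))
              (λ (i , e) → (λ {x} → drop-∷-⊆ i {x}) , e) (λ (i , e) → (λ {x} → out⊆ i {x}) , e)))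
           (countSubsets Q 0))
    (∑-zero (allSubsets n) (λ S → ⟦⟧-no ((inside ∷ S ⊆? inside ∷ Q) ×-dec (suc ∣ S ∣ ≟ 0)) (λ { (_ , ()) }))))
   (trans (+-identityʳ _) (trans (nC0≡1 ∣ Q ∣) (sym (nC0≡1 (suc ∣ Q ∣))))))
countSubsets {suc n} (inside ∷ Q) (suc k) = trans (∑-allSubsets (λ S → ⟦ (S ⊆? inside ∷ Q) ×-dec (∣ S ∣ ≟ suc k) ⟧))
  (trans (cong₂ _+_
    (trans (∑-cong (allSubsets n) (λ S → ⟦⟧-cong ((outside ∷ S ⊆? inside ∷ Q) ×-dec (∣ S ∣ ≟ suc k)) ((S ⊆? Q) ×-dec (∣ S ∣ ≟ suc k))
              (λ (i , e) → (λ {x} → drop-∷-⊆ i {x}) , e) (λ (i , e) → (λ {x} → out⊆ i {x}) , e)))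
           (countSubsets Q (suc k)))
    (trans (∑-cong (allSubsets n) (λ S → ⟦⟧-cong ((inside ∷ S ⊆? inside ∷ Q) ×-dec (suc ∣ S ∣ ≟ suc k)) ((S ⊆? Q) ×-dec (∣ S ∣ ≟ k))
              (λ (i , e) → (λ {x} → drop-∷-⊆ i {x}) , suc-injective e) (λ (i , e) → (λ {x} → s⊆s i {x}) , cong suc e)))
           (countSubsets Q k)))
   (trans (+-comm (∣ Q ∣ C suc k) (∣ Q ∣ C k)) (nCk+nC[k+1]≡[n+1]C[k+1] ∣ Q ∣ k)))

PointedIn : ∀ {n} → Fin n → Subset n → ℕ → Subset n → Set
PointedIn x Q k S = x ∈ S × S ⊆ Q × ∣ S ∣ ≡ k

pointedIn? : ∀ {n} (x : Fin n) Q k S → Dec (PointedIn x Q k S)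
pointedIn? x Q k S = (x ∈? S) ×-dec (S ⊆? Q) ×-dec (∣ S ∣ ≟ k)

-- Such an S is x together with a k-subset of the other m elements of Q. This gives the degree c₁ of
-- a vertex of K_q, the fan of r-cliques at a light vertex, and, for k = m, the uniqueness of a
-- q-subset of a q-clique.
countPointed : ∀ {n} (x : Fin n) (Q : Subset n) m k → x ∈ Q → ∣ Q ∣ ≡ suc m →
  ∑ (allSubsets n) (λ S → ⟦ pointedIn? x Q (suc k) S ⟧) ≡ m C k
countPointed {suc n} zero (inside ∷ Q) m k x∈ e = trans (∑-allSubsets (λ S → ⟦ pointedIn? zero (inside ∷ Q) (suc k) S ⟧))
  (trans (cong₂ _+_
    (∑-zero (allSubsets n) (λ S → ⟦⟧-no (pointedIn? zero (inside ∷ Q) (suc k) (outside ∷ S)) (λ { (() , _) })))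
    (trans (∑-cong (allSubsets n) (λ S → ⟦⟧-cong (pointedIn? zero (inside ∷ Q) (suc k) (inside ∷ S)) ((S ⊆? Q) ×-dec (∣ S ∣ ≟ k))
      (λ (_ , i , e) → (λ {x} → drop-∷-⊆ i {x}) , suc-injective e) (λ (i , e) → here , (λ {x} → s⊆s i {x}) , cong suc e)))
      (countSubsets Q k)))
  (cong (_C k) (suc-injective e)))
countPointed {suc n} (suc x) (outside ∷ Q) m k (there x∈) e = trans (∑-allSubsets (λ S → ⟦ pointedIn? (suc x) (outside ∷ Q) (suc k) S ⟧))
  (trans (cong₂ _+_
    (trans (∑-cong (allSubsets n) (λ S → ⟦⟧-cong (pointedIn? (suc x) (outside ∷ Q) (suc k) (outside ∷ S)) (pointedIn? x Q (suc k) S)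
      (λ (h , i , e) → drop-there h , (λ {x} → drop-∷-⊆ i {x}) , e) (λ (h , i , e) → there h , (λ {x} → s⊆s i {x}) , e)))
      (countPointed x Q m k x∈ e))
    (∑-zero (allSubsets n) (λ S → ⟦⟧-no (pointedIn? (suc x) (outside ∷ Q) (suc k) (inside ∷ S)) (λ (_ , i , _) → in⊈out i))))
   (+-identityʳ _))
countPointed {suc n} (suc x) (inside ∷ Q) zero k (there x∈) e =
  ⊥-elim (1+n≰n (≤-trans (x∈p⇒∣p∣>0 Q x∈) (≤-reflexive (suc-injective e))))
countPointed {suc n} (suc x) (inside ∷ Q) (suc m) k (there x∈) e = trans (∑-allSubsets (λ S → ⟦ pointedIn? (suc x) (inside ∷ Q) (suc k) S ⟧))
  (trans (cong₂ _+_
    (trans (∑-cong (allSubsets n) (λ S → ⟦⟧-cong (pointedIn? (suc x) (inside ∷ Q) (suc k) (outside ∷ S)) (pointedIn? x Q (suc k) S)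
      (λ (h , i , e) → drop-there h , (λ {x} → drop-∷-⊆ i {x}) , e) (λ (h , i , e) → there h , (λ {x} → out⊆ i {x}) , e)))
      (countPointed x Q m k x∈ (suc-injective e)))
    (trans (∑-cong (allSubsets n) (λ S → ⟦⟧-cong (pointedIn? (suc x) (inside ∷ Q) (suc k) (inside ∷ S)) (pointedIn? x Q k S)
      (λ (h , i , e) → drop-there h , (λ {x} → drop-∷-⊆ i {x}) , suc-injective e) (λ (h , i , e) → there h , (λ {x} → s⊆s i {x}) , cong suc e)))
      (rest k)))
   (pascal k))
  where
  -- Stands for C(m, k-1), with value 0 at k = 0, so that Pascal's rule also covers the boundary.
  below : ℕ → ℕ
  below zero    = 0
  below (suc k) = m C k
  rest : ∀ k → ∑ (allSubsets n) (λ S → ⟦ pointedIn? x Q k S ⟧) ≡ below k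
  rest zero    = ∑-zero (allSubsets n) (λ S → ⟦⟧-no (pointedIn? x Q 0 S)
                   (λ (h , _ , e) → 1+n≰n (≤-trans (x∈p⇒∣p∣>0 S h) (≤-reflexive e))))
  rest (suc k) = countPointed x Q m k x∈ (suc-injective e)
  pascal : ∀ k → m C k + below k ≡ suc m C k
  pascal zero    = trans (+-identityʳ _) (trans (nC0≡1 m) (sym (nC0≡1 (suc m))))
  pascal (suc k) = trans (+-comm (m C suc k) (m C k)) (nCk+nC[k+1]≡[n+1]C[k+1] m k)

-- Subsets cut out by decidable predicates

select : ∀ {n a} {P : Fin n → Set a} → (∀ x → Dec (P x)) → Subset n
select P? = tabulate (λ x → does (P? x))

∈-select⁺ : ∀ {n a} {P : Fin n → Set a} (P? : ∀ x → Dec (P x)) {x} → P x → x ∈ select P?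
∈-select⁺ P? {x} p = lookup⇒[]= x _ (trans (lookup∘tabulate _ x) (dec-true (P? x) p))

does⁻ : ∀ {a} {P : Set a} (d : Dec P) → does d ≡ true → P
does⁻ (yes p) e = p

∈-select⁻ : ∀ {n a} {P : Fin n → Set a} (P? : ∀ x → Dec (P x)) {x} → x ∈ select P? → P x
∈-select⁻ P? {x} x∈ = does⁻ (P? x) (trans (sym (lookup∘tabulate _ x)) ([]=⇒lookup x∈))

disjoint⇒∣p∣+∣q∣≤∣p∪q∣ : ∀ {n} (p q : Subset n) → (∀ {x} → x ∈ p → x ∉ q) → ∣ p ∣ + ∣ q ∣ ≤ ∣ p ∪ q ∣
disjoint⇒∣p∣+∣q∣≤∣p∪q∣ []            []            h = z≤n
disjoint⇒∣p∣+∣q∣≤∣p∪q∣ (outside ∷ p) (outside ∷ q) h = disjoint⇒∣p∣+∣q∣≤∣p∪q∣ p q (λ i j → h (there i) (there j))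
disjoint⇒∣p∣+∣q∣≤∣p∪q∣ (inside ∷ p)  (outside ∷ q) h = s≤s (disjoint⇒∣p∣+∣q∣≤∣p∪q∣ p q (λ i j → h (there i) (there j)))
disjoint⇒∣p∣+∣q∣≤∣p∪q∣ (outside ∷ p) (inside ∷ q)  h = ≤-trans (≤-reflexive (+-suc ∣ p ∣ ∣ q ∣))
  (s≤s (disjoint⇒∣p∣+∣q∣≤∣p∪q∣ p q (λ i j → h (there i) (there j))))
disjoint⇒∣p∣+∣q∣≤∣p∪q∣ (inside ∷ p)  (inside ∷ q)  h = ⊥-elim (h here here)

-- Chains: blow-ups of a path in which every vertex becomes a clique

label : (ss : List ℕ) → Fin (sum ss) → ℕ
label (s ∷ ss) i = [ const 0 , suc ∘ label ss ]′ (splitAt s i)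

Close : ℕ → ℕ → Set
Close i j = i ≤ suc j × j ≤ suc i

close? : ∀ i j → Dec (Close i j)
close? i j = (i ≤? suc j) ×-dec (j ≤? suc i)

module _ (ss : List ℕ) where

  ChainAdj : Fin (sum ss) → Fin (sum ss) → Set
  ChainAdj i j = i ≢ j × Close (label ss i) (label ss j)

  chainAdj? : ∀ i j → Dec (ChainAdj i j)
  chainAdj? i j = ¬? (i ≟ᶠ j) ×-dec close? (label ss i) (label ss j)

  chain : Graph
  chain = graph (sum ss) record
    { adj    = λ i j → does (chainAdj? i j)
    ; sym    = λ i j → does-⇔ (mk⇔ flip′ flip′) (chainAdj? i j) (chainAdj? j i)
    ; irrefl = λ i → dec-false (chainAdj? i i) (λ (ne , _) → ne refl) }
    where
    flip′ : ∀ {i j} → ChainAdj i j → ChainAdj j i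
    flip′ (ne , c , d) = ne ∘ sym , d , c

-- Zero past the end, so layers can be indexed by all naturals and size lists can be padded with 0.
size : List ℕ → ℕ → ℕ
size []       _       = 0
size (s ∷ ss) zero    = s
size (s ∷ ss) (suc k) = size ss k

embed : ∀ ss k → Fin (size ss k) → Fin (sum ss)
embed (s ∷ ss) zero    i = i ↑ˡ sum ss
embed (s ∷ ss) (suc k) i = s ↑ʳ embed ss k i

label-embed : ∀ ss k i → label ss (embed ss k i) ≡ k
label-embed (s ∷ ss) zero    i rewrite splitAt-↑ˡ s i (sum ss) = refl
label-embed (s ∷ ss) (suc k) i rewrite splitAt-↑ʳ s (sum ss) (embed ss k i) = cong suc (label-embed ss k i)

embed-injective : ∀ ss k → Injective _≡_ _≡_ (embed ss k)
embed-injective (s ∷ ss) zero    e = ↑ˡ-injective (sum ss) _ _ e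
embed-injective (s ∷ ss) (suc k) e = embed-injective ss k (↑ʳ-injective s _ _ e)

CliqueIn : ∀ {n} → (Fin n → Fin n → Set) → Subset n → Set
CliqueIn E S = ∀ x y → x ∈ S → y ∈ S → x ≢ y → E x y

-- A copy of a chain restated as vertex sets, which can be cut, exchanged and enlarged more easily
-- than an embedding. Layers may be larger than `size` asks and may have further edges between them,
-- because copies need not be induced.
record Layers (ss : List ℕ) {n} (E : Fin n → Fin n → Set) : Set where
  field
    layer    : ℕ → Subset n
    large    : ∀ k → size ss k ≤ ∣ layer k ∣
    disjoint : ∀ {i j x} → x ∈ layer i → x ∈ layer j → i ≡ j
    joined   : ∀ {i j x y} → Close i j → x ∈ layer i → y ∈ layer j → x ≢ y → E x y

  apart : ∀ {i j} → i ≢ j → ∀ {x} → x ∈ layer i → x ∉ layer j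
  apart i≢j a b = i≢j (disjoint a b)

  pair : ℕ → Subset n
  pair k = layer k ∪ layer (suc k)

  pair-clique : ∀ k → CliqueIn E (pair k)
  pair-clique k x y x∈ y∈ x≢y with x∈p∪q⁻ (layer k) (layer (suc k)) x∈ | x∈p∪q⁻ (layer k) (layer (suc k)) y∈
  ... | inj₁ a | inj₁ b = joined (n≤1+n _ , n≤1+n _) a b x≢y
  ... | inj₁ a | inj₂ b = joined (m≤n+m k 2 , ≤-refl) a b x≢y
  ... | inj₂ a | inj₁ b = joined (≤-refl , m≤n+m k 2) a b x≢y
  ... | inj₂ a | inj₂ b = joined (n≤1+n _ , n≤1+n _) a b x≢y

  pair-large : ∀ k → size ss k + size ss (suc k) ≤ ∣ pair k ∣
  pair-large k = ≤-trans (+-mono-≤ (large k) (large (suc k)))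
    (disjoint⇒∣p∣+∣q∣≤∣p∪q∣ (layer k) (layer (suc k)) (apart (1+n≢n ∘ sym)))

copy⇒layers : ∀ ss {n} {E : Fin n → Fin n → Set} → CopyIn (chain ss) E → Layers ss E
copy⇒layers ss {n} {E} (f , inj , hom) = record
  { layer = λ k → select (InLayer? k)
  ; large = λ k → injection⇒≤∣∣ (size ss k) (f ∘ embed ss k) _ (λ e → embed-injective ss k (inj e))
                    (λ i → ∈-select⁺ (InLayer? k) (embed ss k i , label-embed ss k i , refl))
  ; disjoint = λ {i} {j} a b → disj (∈-select⁻ (InLayer? i) a) (∈-select⁻ (InLayer? j) b)
  ; joined = λ {i} {j} c a b ne → join (∈-select⁻ (InLayer? i) a) (∈-select⁻ (InLayer? j) b) c ne }
  where
  InLayer : ℕ → Fin n → Set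
  InLayer k y = ∃ λ i → label ss i ≡ k × f i ≡ y
  InLayer? : ∀ k y → Dec (InLayer k y)
  InLayer? k y = any? (λ i → (label ss i ≟ k) ×-dec (f i ≟ᶠ y))
  disj : ∀ {i j x} → InLayer i x → InLayer j x → i ≡ j
  disj (a , refl , e) (b , refl , e′) = cong (label ss) (inj (trans e (sym e′)))
  join : ∀ {i j x y} → InLayer i x → InLayer j y → Close i j → x ≢ y → E x y
  join (a , refl , refl) (b , refl , refl) c ne = hom a b (dec-true (chainAdj? ss a b) (ne ∘ cong f , c))

layers⇒copy : ∀ ss {n} {E : Fin n → Fin n → Set} → Layers ss E → CopyIn (chain ss) E
layers⇒copy ss {n} {E} L =
  let f , inj , mem = place ss layer large disjoint
  in f , inj , λ x y a → let ne , c = does⁻ (chainAdj? ss x y) a in joined c (mem x) (mem y) (ne ∘ inj)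
  where
  open Layers L
  -- The recursion carries only sizes and disjointness, both of which survive the shift `L ∘ suc`;
  -- edges are read off afterwards from the labels.
  place : ∀ ss (L : ℕ → Subset n) → (∀ k → size ss k ≤ ∣ L k ∣) → (∀ {i j x} → x ∈ L i → x ∈ L j → i ≡ j) →
          ∃ λ (f : Fin (sum ss) → Fin n) → Injective _≡_ _≡_ f × (∀ i → f i ∈ L (label ss i))
  place []       L lg dj = (λ ()) , (λ {}) , λ ()
  place (s ∷ ss) L lg dj = f , f-inj , f-mem
    where
    hd = ≤∣∣⇒injection s (L 0) (lg 0)
    tl = place ss (L ∘ suc) (lg ∘ suc) (λ a b → suc-injective (dj a b))
    g = proj₁ hd
    h = proj₁ tl
    f : Fin (s + sum ss) → Fin n
    f i = [ g , h ]′ (splitAt s i)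
    f-mem : ∀ i → f i ∈ L (label (s ∷ ss) i)
    f-mem i with splitAt s i
    ... | inj₁ a = proj₂ (proj₂ hd) a
    ... | inj₂ b = proj₂ (proj₂ tl) b
    f-inj : Injective _≡_ _≡_ f
    f-inj {i} {j} e with splitAt s i in p | splitAt s j in q
    ... | inj₁ a | inj₁ b = trans (sym (splitAt⁻¹-↑ˡ p)) (trans (cong (_↑ˡ sum ss) (proj₁ (proj₂ hd) e)) (splitAt⁻¹-↑ˡ q))
    ... | inj₁ a | inj₂ b with () ← dj (proj₂ (proj₂ hd) a) (subst (_∈ L _) (sym e) (proj₂ (proj₂ tl) b))
    ... | inj₂ a | inj₁ b with () ← dj (proj₂ (proj₂ hd) b) (subst (_∈ L _) e (proj₂ (proj₂ tl) a))
    ... | inj₂ a | inj₂ b = trans (sym (splitAt⁻¹-↑ʳ p)) (trans (cong (s ↑ʳ_) (proj₁ (proj₂ tl) e)) (splitAt⁻¹-↑ʳ q))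

-- Close layers are equal or consecutive, so three cliques on consecutive unions supply all edges.
-- The three forbidden chains are all written with four parts to fit this shape.
fourLayers : ∀ {a b c d n} {E : Fin n → Fin n → Set} (X Y Z W : Subset n) →
  a ≤ ∣ X ∣ → b ≤ ∣ Y ∣ → c ≤ ∣ Z ∣ → d ≤ ∣ W ∣ →
  (∀ {x} → x ∈ X → x ∉ Y) → (∀ {x} → x ∈ X → x ∉ Z) → (∀ {x} → x ∈ X → x ∉ W) →
  (∀ {x} → x ∈ Y → x ∉ Z) → (∀ {x} → x ∈ Y → x ∉ W) → (∀ {x} → x ∈ Z → x ∉ W) →
  CliqueIn E (X ∪ Y) → CliqueIn E (Y ∪ Z) → CliqueIn E (Z ∪ W) →
  Layers (a ∷ b ∷ c ∷ d ∷ []) E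
fourLayers {a} {b} {c} {d} {n} {E} X Y Z W hX hY hZ hW XY XZ XW YZ YW ZW cXY cYZ cZW = record
  { layer = L ; large = lg ; disjoint = λ {i} {j} → dj i j ; joined = λ {i} {j} → jn i j }
  where
  L : ℕ → Subset n
  L 0 = X
  L 1 = Y
  L 2 = Z
  L 3 = W
  L _ = ⊥
  lg : ∀ k → size (a ∷ b ∷ c ∷ d ∷ []) k ≤ ∣ L k ∣
  lg 0 = hX
  lg 1 = hY
  lg 2 = hZ
  lg 3 = hW
  lg (suc (suc (suc (suc _)))) = z≤n
  dj : ∀ i j {x} → x ∈ L i → x ∈ L j → i ≡ j
  dj 0 0 p q = refl
  dj 0 1 p q = ⊥-elim (XY p q)
  dj 0 2 p q = ⊥-elim (XZ p q)
  dj 0 3 p q = ⊥-elim (XW p q)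
  dj 1 0 p q = ⊥-elim (XY q p)
  dj 1 1 p q = refl
  dj 1 2 p q = ⊥-elim (YZ p q)
  dj 1 3 p q = ⊥-elim (YW p q)
  dj 2 0 p q = ⊥-elim (XZ q p)
  dj 2 1 p q = ⊥-elim (YZ q p)
  dj 2 2 p q = refl
  dj 2 3 p q = ⊥-elim (ZW p q)
  dj 3 0 p q = ⊥-elim (XW q p)
  dj 3 1 p q = ⊥-elim (YW q p)
  dj 3 2 p q = ⊥-elim (ZW q p)
  dj 3 3 p q = refl
  dj (suc (suc (suc (suc i)))) j p q = ⊥-elim (∉⊥ p)
  dj i (suc (suc (suc (suc j)))) p q = ⊥-elim (∉⊥ q)
  l : ∀ {x} (P Q : Subset n) → x ∈ P → x ∈ P ∪ Q
  l P Q = p⊆p∪q {p = P} Q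
  r : ∀ {x} (P Q : Subset n) → x ∈ Q → x ∈ P ∪ Q
  r P Q = q⊆p∪q P Q
  jn : ∀ i j {x y} → Close i j → x ∈ L i → y ∈ L j → x ≢ y → E x y
  jn 0 0 _ p q = cXY _ _ (l X Y p) (l X Y q)
  jn 0 1 _ p q = cXY _ _ (l X Y p) (r X Y q)
  jn 1 0 _ p q = cXY _ _ (r X Y p) (l X Y q)
  jn 1 1 _ p q = cXY _ _ (r X Y p) (r X Y q)
  jn 1 2 _ p q = cYZ _ _ (l Y Z p) (r Y Z q)
  jn 2 1 _ p q = cYZ _ _ (r Y Z p) (l Y Z q)
  jn 2 2 _ p q = cYZ _ _ (r Y Z p) (r Y Z q)
  jn 2 3 _ p q = cZW _ _ (l Z W p) (r Z W q)
  jn 3 2 _ p q = cZW _ _ (r Z W p) (l Z W q)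
  jn 3 3 _ p q = cZW _ _ (r Z W p) (r Z W q)
  jn 0 2 (_ , s≤s ()) p q
  jn 0 3 (_ , s≤s ()) p q
  jn 1 3 (_ , s≤s (s≤s ())) p q
  jn 2 0 (s≤s () , _) p q
  jn 3 0 (s≤s () , _) p q
  jn 3 1 (s≤s (s≤s ()) , _) p q
  jn (suc (suc (suc (suc i)))) j _ p q = ⊥-elim (∉⊥ p)
  jn i (suc (suc (suc (suc j)))) _ p q = ⊥-elim (∉⊥ q)

threeLayers : ∀ {a b c n} {E : Fin n → Fin n → Set} (X Y Z : Subset n) →
  a ≤ ∣ X ∣ → b ≤ ∣ Y ∣ → c ≤ ∣ Z ∣ →
  (∀ {x} → x ∈ X → x ∉ Y) → (∀ {x} → x ∈ X → x ∉ Z) → (∀ {x} → x ∈ Y → x ∉ Z) →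
  CliqueIn E (X ∪ Y) → CliqueIn E (Y ∪ Z) → Layers (a ∷ b ∷ c ∷ 0 ∷ []) E
threeLayers X Y Z hX hY hZ XY XZ YZ cXY cYZ =
  fourLayers X Y Z ⊥ hX hY hZ z≤n XY XZ (λ _ → ∉⊥) YZ (λ _ → ∉⊥) (λ _ → ∉⊥) cXY cYZ
    (λ x y a b → cYZ x y (q⊆p∪q Y Z (Z∪⊥⊆Z a)) (q⊆p∪q Y Z (Z∪⊥⊆Z b)))
  where
  Z∪⊥⊆Z : Z ∪ ⊥ ⊆ Z
  Z∪⊥⊆Z x∈ = [ id , ⊥-elim ∘ ∉⊥ ]′ (x∈p∪q⁻ Z ⊥ x∈)

-- Existence of sat(n, K_r, F) by finite search

copy-mono : ∀ H {n} (E E′ : Fin n → Fin n → Set) → (∀ {x y} → E x y → E′ x y) → CopyIn H E → CopyIn H E′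
copy-mono H E E′ h (f , inj , hom) = f , inj , λ x y a → h (hom x y a)

-- Functions are enumerated value by value; a function rebuilt from its values agrees with the
-- original only pointwise, hence the second hypothesis.
anyFun? : ∀ m {n} {P : (Fin m → Fin n) → Set} → (∀ f → Dec (P f)) →
          (∀ {f g} → (∀ i → f i ≡ g i) → P f → P g) → Dec (∃ P)
anyFun? zero    {n} P? resp = map′ (λ p → none , p) (λ (f , p) → resp (λ ()) p) (P? none)
  where
  none : Fin 0 → Fin n
  none ()
anyFun? (suc m) {n} {P} P? resp = map′ to from
  (any? (λ x → anyFun? m (λ f → P? (cons x f)) (λ e → resp (λ { zero → refl ; (suc i) → e i }))))
  where
  cons : Fin n → (Fin m → Fin n) → Fin (suc m) → Fin n
  cons x f zero    = x
  cons x f (suc i) = f i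
  to : ∃ (λ x → ∃ λ f → P (cons x f)) → ∃ P
  to (x , f , p) = cons x f , p
  from : ∃ P → ∃ (λ x → ∃ λ f → P (cons x f))
  from (f , p) = f zero , f ∘ suc , resp (λ { zero → refl ; (suc i) → refl }) p

copyIn? : ∀ H {n} {E : Fin n → Fin n → Set} → (∀ x y → Dec (E x y)) → Dec (CopyIn H E)
copyIn? (graph m H) {n} {E} E? = anyFun? m
  (λ f → map′ (λ h {x} {y} → h x y) (λ h x y → h {x} {y}) (all? (λ x → all? (λ y → (f x ≟ᶠ f y) →-dec (x ≟ᶠ y))))
         ×-dec all? (λ x → all? (λ y → (adj H x y Bool.≟ true) →-dec E? (f x) (f y))))
  (λ {f} {g} e (inj , hom) → (λ {x} {y} q → inj (trans (e x) (trans q (sym (e y))))) ,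
     λ x y a → subst₂ E (e x) (e y) (hom x y a))

containsFam? : ∀ F {n} {E : Fin n → Fin n → Set} → (∀ x y → Dec (E x y)) → Dec (ContainsFam F E)
containsFam? F E? = any? (λ i → copyIn? (member F i) E?)

adj? : ∀ {n} (G : SimpleGraph n) x y → Dec (Adj G x y)
adj? G x y = adj G x y Bool.≟ true

addEdge? : ∀ {n} (G : SimpleGraph n) u v x y → Dec (AddEdge G u v x y)
addEdge? G u v x y = adj? G x y ⊎-dec (((x ≟ᶠ u) ×-dec (y ≟ᶠ v)) ⊎-dec ((x ≟ᶠ v) ×-dec (y ≟ᶠ u)))

saturated? : ∀ F {n} (G : SimpleGraph n) → Dec (Saturated F G)
saturated? F G = ¬? (containsFam? F (adj? G)) ×-dec
  all? (λ u → all? (λ v → ¬? (u ≟ᶠ v) →-dec (¬? (adj? G u v) →-dec containsFam? F (addEdge? G u v))))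

infix 4 _≈_

_≈_ : ∀ {n} → SimpleGraph n → SimpleGraph n → Set
G ≈ H = ∀ x y → adj G x y ≡ adj H x y

saturated-≈ : ∀ F {n} {G H : SimpleGraph n} → G ≈ H → Saturated F G → Saturated F H
saturated-≈ F {G = G} {H} e (free , sat) =
  (λ (i , c) → free (i , copy-mono (member F i) (Adj H) (Adj G) (λ {x} {y} → trans (e x y)) c)) ,
  λ u v ne na → let i , c = sat u v ne (λ a → na (trans (sym (e u v)) a)) in
    i , copy-mono (member F i) (AddEdge G u v) (AddEdge H u v) (λ { (inj₁ a) → inj₁ (trans (sym (e _ _)) a) ; (inj₂ b) → inj₂ b }) c

copiesK-∑ : ∀ {n} (G : SimpleGraph n) r →
  copiesK G r ≡ ∑ (allSubsets n) (λ S → ⟦ (∣ S ∣ ≟ r) ×-dec isClique? G S ⟧)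
copiesK-∑ {n} G r = length-filter (λ S → (∣ S ∣ ≟ r) ×-dec isClique? G S) (allSubsets n)

copiesK-≈ : ∀ {n} {G H : SimpleGraph n} r → G ≈ H → copiesK G r ≡ copiesK H r
copiesK-≈ {n} {G} {H} r e = trans (copiesK-∑ G r) (trans
  (∑-cong (allSubsets n) (λ S → ⟦⟧-cong ((∣ S ∣ ≟ r) ×-dec isClique? G S) ((∣ S ∣ ≟ r) ×-dec isClique? H S)
    (λ (s , c) → s , λ x y a b ne → trans (sym (e x y)) (c x y a b ne))
    (λ (s , c) → s , λ x y a b ne → trans (e x y) (c x y a b ne))))
  (sym (copiesK-∑ H r)))

module _ (n : ℕ) where

  -- Symmetrising and clearing the diagonal turns every set of cells into a graph, so a search over
  -- graphs becomes a search over subsets, which `anySubset?` decides.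
  matrixAdj : Subset (n * n) → Fin n → Fin n → Bool
  matrixAdj p x y = not (does (x ≟ᶠ y)) ∧ (lookup p (combine x y) ∨ lookup p (combine y x))

  matrixGraph : Subset (n * n) → SimpleGraph n
  matrixGraph p = record
    { adj    = matrixAdj p
    ; sym    = λ x y → cong₂ (λ b c → not b ∧ c) (does-⇔ (mk⇔ sym sym) (x ≟ᶠ y) (y ≟ᶠ x))
                 (Bool.∨-comm (lookup p (combine x y)) _)
    ; irrefl = irr }
    where
    irr : ∀ x → matrixAdj p x x ≡ false
    irr x with x ≟ᶠ x
    ... | yes _ = refl
    ... | no ne = ⊥-elim (ne refl)

  encode : SimpleGraph n → Subset (n * n)
  encode G = tabulate (λ k → uncurry (adj G) (remQuot n k))

  encode-≈ : ∀ G → matrixGraph (encode G) ≈ G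
  encode-≈ G x y with x ≟ᶠ y
  ... | yes refl = sym (irrefl G x)
  ... | no _     = trans (cong₂ _∨_ (entry x y) (trans (entry y x) (SimpleGraph.sym G y x))) (Bool.∨-idem _)
    where
    entry : ∀ x y → lookup (encode G) (combine x y) ≡ adj G x y
    entry x y = trans (lookup∘tabulate _ (combine x y)) (cong (uncurry (adj G)) (remQuot-combine x y))

  matrix-edge : ∀ {p x y} → Adj (matrixGraph p) x y → combine x y ∈ p ⊎ combine y x ∈ p
  matrix-edge {p} {x} {y} a with x ≟ᶠ y | lookup p (combine x y) in e | lookup p (combine y x) in e′
  ... | no _ | true  | _    = inj₁ (lookup⇒[]= _ p e)
  ... | no _ | false | true = inj₂ (lookup⇒[]= _ p e′)

  edge-matrix : ∀ {p x y} → x ≢ y → combine x y ∈ p → Adj (matrixGraph p) x y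
  edge-matrix {p} {x} {y} ne x∈ with x ≟ᶠ y
  ... | yes e = ⊥-elim (ne e)
  ... | no _ rewrite []=⇒lookup x∈ = refl

  matrix-sym : ∀ p {x y} → Adj (matrixGraph p) x y → Adj (matrixGraph p) y x
  matrix-sym p {x} {y} a = trans (SimpleGraph.sym (matrixGraph p) y x) a

  add-cell : ∀ {p} u v {x y} → Adj (matrixGraph (p ∪ ⁅ combine u v ⁆)) x y → AddEdge (matrixGraph p) u v x y
  add-cell {p} u v {x} {y} a = [ cell x y x≢y , flip′ ∘ cell y x (x≢y ∘ sym) ]′ (matrix-edge {p ∪ ⁅ combine u v ⁆} a)
    where
    x≢y : x ≢ y
    x≢y refl with () ← trans (sym (irrefl (matrixGraph (p ∪ ⁅ combine u v ⁆)) x)) a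
    cell : ∀ x y → x ≢ y → combine x y ∈ p ∪ ⁅ combine u v ⁆ → AddEdge (matrixGraph p) u v x y
    cell x y ne c with x∈p∪q⁻ p _ c
    ... | inj₁ d = inj₁ (edge-matrix {p} ne d)
    ... | inj₂ d = inj₂ (inj₁ (combine-injective x y u v (x∈⁅y⁆⇒x≡y _ d)))
    flip′ : AddEdge (matrixGraph p) u v y x → AddEdge (matrixGraph p) u v x y
    flip′ (inj₁ e)              = inj₁ (matrix-sym p e)
    flip′ (inj₂ (inj₁ (e , f))) = inj₂ (inj₂ (f , e))
    flip′ (inj₂ (inj₂ (e , f))) = inj₂ (inj₁ (f , e))

  -- Greedy saturation: while some missing edge creates no forbidden copy, it is added, which keeps
  -- the graph free. Each addition fills a new cell, so n² steps suffice.
  grow : ∀ F fuel p → n * n ≤ fuel + ∣ p ∣ → ¬ ContainsFam F (Adj (matrixGraph p)) →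
         ∃ λ p′ → Saturated F (matrixGraph p′)
  grow F fuel p bound free with any? (λ u → any? (λ v → ¬? (u ≟ᶠ v) ×-dec (¬? (adj? (matrixGraph p) u v) ×-dec
                                      ¬? (containsFam? F (addEdge? (matrixGraph p) u v)))))
  ... | no none = p , free , λ u v ne na → decidable-stable (containsFam? F (addEdge? (matrixGraph p) u v))
                    (λ nc → none (u , v , ne , na , nc))
  ... | yes (u , v , ne , na , nc) = next fuel bound
    where
    p⁺ = p ∪ ⁅ combine u v ⁆
    p<p⁺ : ∣ p ∣ < ∣ p⁺ ∣
    p<p⁺ = p⊂q⇒∣p∣<∣q∣ (p⊆p∪q _ , combine u v , q⊆p∪q p _ (x∈⁅x⁆ _) , λ m → na (edge-matrix {p} ne m))
    next : ∀ fuel → n * n ≤ fuel + ∣ p ∣ → ∃ λ p′ → Saturated F (matrixGraph p′)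
    next zero    b = ⊥-elim (1+n≰n (≤-trans p<p⁺ (≤-trans (∣p∣≤n p⁺) b)))
    next (suc f) b = grow F f p⁺ (≤-trans b (≤-trans (≤-reflexive (sym (+-suc f ∣ p ∣))) (+-monoʳ-≤ f p<p⁺)))
                       (λ (i , c) → nc (i , copy-mono (member F i) (Adj (matrixGraph p⁺)) (AddEdge (matrixGraph p) u v) (add-cell {p} u v) c))

least : ∀ {P : ℕ → Set} → (∀ s → Dec (P s)) → ∀ c → P c → ∃ λ s → P s × (∀ t → P t → s ≤ t)
least {P} P? = <-rec _ step
  where
  step : ∀ c → (∀ {d} → d < c → P d → ∃ λ s → P s × (∀ t → P t → s ≤ t)) → P c → ∃ λ s → P s × (∀ t → P t → s ≤ t)
  step c rec pc with anyUpTo? P? c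
  ... | yes (d , d<c , pd) = rec d<c pd
  ... | no none = c , pc , λ t pt → ≮⇒≥ (λ t<c → none (t , t<c , pt))

-- The hypothesis lets `grow` start from the edgeless graph, so some value is attained; being
-- attained is decidable on encoded graphs, so there is a least attained value. Every graph is
-- pointwise equal to an encoded one, hence the minimum is over all graphs.
sat-exists : ∀ F → (∀ {n} → ¬ ContainsFam F {n} (λ _ _ → Absurd)) → ∀ r n → ∃ λ s → IsSat F r n s
sat-exists F edgy r n =
  let p₀ , sat₀ = grow n F (n * n) ⊥ (m≤m+n _ _) (λ (i , c) → edgy (i , copy-mono (member F i) (Adj (matrixGraph n ⊥)) (λ _ _ → Absurd) no-edge c))
      s , (p , sat , e) , min = least {P = Value} (λ s → anySubset? (λ p → saturated? F (matrixGraph n p) ×-dec (copiesK (matrixGraph n p) r ≟ s)))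
                                  (copiesK (matrixGraph n p₀) r) (p₀ , sat₀ , refl)
  in s , (matrixGraph n p , sat , e) , λ G satG → ≤-trans
       (min _ (encode n G , saturated-≈ F {G = G} {matrixGraph n (encode n G)} (λ x y → sym (encode-≈ n G x y)) satG , refl))
       (≤-reflexive (copiesK-≈ {G = matrixGraph n (encode n G)} {G} r (encode-≈ n G)))
  where
  Value : ℕ → Set
  Value s = ∃ λ (p : Subset (n * n)) → Saturated F (matrixGraph n p) × copiesK (matrixGraph n p) r ≡ s
  no-edge : ∀ {x y} → Adj (matrixGraph n ⊥) x y → Absurd
  no-edge {x} {y} a with matrix-edge n {p = ⊥} {x} {y} a
  ... | inj₁ b = ∉⊥ b
  ... | inj₂ b = ∉⊥ b

-- Elementary operations on cliques

clique-⊆ : ∀ {n} {E : Fin n → Fin n → Set} {S T : Subset n} → S ⊆ T → CliqueIn E T → CliqueIn E S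
clique-⊆ i c x y a b = c x y (i a) (i b)

⁅x⁆⊆ : ∀ {n} {x : Fin n} {S : Subset n} → x ∈ S → ⁅ x ⁆ ⊆ S
⁅x⁆⊆ {x = x} x∈ y∈ rewrite x∈⁅y⁆⇒x≡y x y∈ = x∈

∪-⊆ : ∀ {n} {S T A : Subset n} → S ⊆ A → T ⊆ A → S ∪ T ⊆ A
∪-⊆ {S = S} {T} i j x∈ = [ i , j ]′ (x∈p∪q⁻ S T x∈)

adj-sym : ∀ {n} (G : SimpleGraph n) {x y} → Adj G x y → Adj G y x
adj-sym G {x} {y} a = trans (SimpleGraph.sym G y x) a

clique-insert : ∀ {n} (G : SimpleGraph n) {S : Subset n} {u} → IsClique G S → (∀ x → x ∈ S → x ≢ u → Adj G u x) →
                IsClique G (S ∪ ⁅ u ⁆)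
clique-insert G {S} {u} c h x y x∈ y∈ x≢y with x∈p∪q⁻ S ⁅ u ⁆ x∈ | x∈p∪q⁻ S ⁅ u ⁆ y∈
... | inj₁ a | inj₁ b = c x y a b x≢y
... | inj₁ a | inj₂ b with refl ← x∈⁅y⁆⇒x≡y u b = adj-sym G (h x a x≢y)
... | inj₂ a | inj₁ b with refl ← x∈⁅y⁆⇒x≡y u a = h y b (x≢y ∘ sym)
... | inj₂ a | inj₂ b = ⊥-elim (x≢y (trans (x∈⁅y⁆⇒x≡y u a) (sym (x∈⁅y⁆⇒x≡y u b))))

-- The three forbidden chains

module Family (r′ p : ℕ) where

  r q : ℕ
  r = suc r′
  q = suc (p + r′)

  -- With q = p + r: K_q and a vertex joined to r of its vertices; K_q and K_{p+2} sharing a vertex;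
  -- two disjoint K_q joined by an edge.
  sizes : Fin 3 → List ℕ
  sizes zero             = p ∷ r ∷ 1 ∷ 0 ∷ []
  sizes (suc zero)       = p + r′ ∷ 1 ∷ suc p ∷ 0 ∷ []
  sizes (suc (suc zero)) = p + r′ ∷ 1 ∷ 1 ∷ p + r′ ∷ []

  FreeOf : ∀ {n} → (Fin n → Fin n → Set) → Set
  FreeOf E = ∀ i → ¬ CopyIn (chain (sizes i)) E

  p+r≤q : ∀ {m} → q ≤ m → p + r ≤ m
  p+r≤q = ≤-trans (≤-reflexive (+-suc p r′))

  module _ {n : ℕ} (G : SimpleGraph n) where

    QClique : Subset n → Set
    QClique Q = ∣ Q ∣ ≡ q × IsClique G Q

    qClique? : ∀ Q → Dec (QClique Q)
    qClique? Q = (∣ Q ∣ ≟ q) ×-dec isClique? G Q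

    Covered : Fin n → Set
    Covered x = ∃ λ Q → QClique Q × x ∈ Q

    covered? : ∀ x → Dec (Covered x)
    covered? x = anySubset? (λ Q → qClique? Q ×-dec (x ∈? Q))

    covers : ∀ {S x} → IsClique G S → q ≤ ∣ S ∣ → x ∈ S → Covered x
    covers {S} {x} c h x∈ =
      let B , i , j , e = intermediate ⁅ x ⁆ S q (⁅x⁆⊆ x∈) (≤-trans (≤-reflexive (∣⁅x⁆∣≡1 x)) (s≤s z≤n)) h
      in B , (e , clique-⊆ {E = Adj G} {B} {S} j c) , i (x∈⁅x⁆ x)

    -- Suppose z is in Q′ but not in Q. If the overlap has r vertices, then r of them, the rest of Q
    -- and z form the first chain. Otherwise at least q - (r - 1) = p + 1 vertices of Q′ lie outside
    -- Q, and Q and these, glued at x, form the second chain.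
    qclique-unique : FreeOf (Adj G) → ∀ {Q Q′ x} → QClique Q → QClique Q′ → x ∈ Q → x ∈ Q′ → Q′ ⊆ Q
    qclique-unique free {Q} {Q′} {x} (s , c) (s′ , c′) x∈Q x∈Q′ {z} z∈Q′ =
      decidable-stable (z ∈? Q) λ z∉Q → absurd z∉Q (r ≤? ∣ Q ∩ Q′ ∣)
      where
      absurd : z ∉ Q → Dec (r ≤ ∣ Q ∩ Q′ ∣) → Absurd
      absurd z∉Q (yes big) = free zero (layers⇒copy (sizes zero)
        (threeLayers (Q ─ S) S ⁅ z ⁆ big₀ (≤-reflexive (sym e)) (≤-reflexive (sym (∣⁅x⁆∣≡1 z)))
          (x∈p─q⇒x∉q Q S) (λ a b → z∉Q (subst (_∈ Q) (x∈⁅y⁆⇒x≡y z b) (p─q⊆p Q S a)))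
          (λ a b → z∉Q (subst (_∈ Q) (x∈⁅y⁆⇒x≡y z b) (S⊆Q a)))
          (clique-⊆ {E = Adj G} {T = Q} (∪-⊆ {S = Q ─ S} {S} (p─q⊆p Q S) S⊆Q) c)
          (clique-⊆ {E = Adj G} {T = Q′} (∪-⊆ {S = S} {⁅ z ⁆} S⊆Q′ (⁅x⁆⊆ z∈Q′)) c′)))
        where
        core = intermediate ⊥ (Q ∩ Q′) r ⊥⊆ (≤-trans (≤-reflexive (∣⊥∣≡0 n)) z≤n) big
        S = proj₁ core
        e : ∣ S ∣ ≡ r
        e = proj₂ (proj₂ (proj₂ core))
        S⊆Q : S ⊆ Q
        S⊆Q = p∩q⊆p Q Q′ ∘ proj₁ (proj₂ (proj₂ core))
        S⊆Q′ : S ⊆ Q′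
        S⊆Q′ = p∩q⊆q Q Q′ ∘ proj₁ (proj₂ (proj₂ core))
        big₀ : p ≤ ∣ Q ─ S ∣
        big₀ = +-cancelʳ-≤ r p ∣ Q ─ S ∣
          (≤-trans (p+r≤q (≤-reflexive (sym s))) (≤-trans (∣p∣≤∣p─q∣+∣q∣ Q S) (+-monoʳ-≤ ∣ Q ─ S ∣ (≤-reflexive e))))
      absurd z∉Q (no small) = free (suc zero) (layers⇒copy (sizes (suc zero))
        (threeLayers (Q - x) ⁅ x ⁆ (Q′ ─ Q) (s≤s⁻¹ (≤-trans (≤-reflexive (sym s)) (∣p∣≤1+∣p-x∣ Q x)))
          (≤-reflexive (sym (∣⁅x⁆∣≡1 x))) big₂
          (x∈p─q⇒x∉q Q ⁅ x ⁆) (λ a b → x∈p─q⇒x∉q Q′ Q b (p─q⊆p Q ⁅ x ⁆ a))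
          (λ a b → x∈p─q⇒x∉q Q′ Q b (⁅x⁆⊆ x∈Q a))
          (clique-⊆ {E = Adj G} {T = Q} (∪-⊆ {S = Q - x} {⁅ x ⁆} (p─q⊆p Q ⁅ x ⁆) (⁅x⁆⊆ x∈Q)) c)
          (clique-⊆ {E = Adj G} {T = Q′} (∪-⊆ {S = ⁅ x ⁆} {Q′ ─ Q} (⁅x⁆⊆ x∈Q′) (p─q⊆p Q′ Q)) c′)))
        where
        Q′⊆ : Q′ ⊆ (Q′ ─ Q) ∪ (Q ∩ Q′)
        Q′⊆ {y} y∈ with y ∈? Q
        ... | yes m = q⊆p∪q (Q′ ─ Q) _ (x∈p∩q⁺ (m , y∈))
        ... | no ¬m = p⊆p∪q {p = Q′ ─ Q} _ (x∈p∧x∉q⇒x∈p─q y∈ ¬m)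
        big₂ : suc p ≤ ∣ Q′ ─ Q ∣
        big₂ = +-cancelʳ-≤ r′ (suc p) ∣ Q′ ─ Q ∣ (begin
          q                              ≡⟨ s′ ⟨
          ∣ Q′ ∣                          ≤⟨ p⊆q⇒∣p∣≤∣q∣ Q′⊆ ⟩
          ∣ (Q′ ─ Q) ∪ (Q ∩ Q′) ∣         ≤⟨ ∣p∪q∣≤∣p∣+∣q∣ (Q′ ─ Q) (Q ∩ Q′) ⟩
          ∣ Q′ ─ Q ∣ + ∣ Q ∩ Q′ ∣          ≤⟨ +-monoʳ-≤ ∣ Q′ ─ Q ∣ (s≤s⁻¹ (≰⇒> small)) ⟩
          ∣ Q′ ─ Q ∣ + r′                 ∎)
          where open ≤-Reasoning

  -- Consequences of saturation for vertices outside the q-cliques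

  module Saturation (2≤r′ : 2 ≤ r′) (r≤p : r ≤ p) {n : ℕ} (G : SimpleGraph n) (free : FreeOf (Adj G))
    (sat : ∀ u v → u ≢ v → ¬ Adj G u v → ∃ λ i → CopyIn (chain (sizes i)) (AddEdge G u v)) where

    r+1≤p+2 : suc r ≤ suc (suc p)
    r+1≤p+2 = s≤s (m≤n⇒m≤1+n r≤p)

    p+2≤q : suc (suc p) ≤ q
    p+2≤q = s≤s (≤-trans (≤-reflexive (+-comm 1 p)) (+-monoʳ-≤ p (≤-trans (s≤s z≤n) 2≤r′)))

    module _ (u v : Fin n) where

      Both : Subset n → Set
      Both S = u ∈ S × v ∈ S

      both? : ∀ S → Dec (Both S)
      both? S = (u ∈? S) ×-dec (v ∈? S)

      clique-old : ∀ S → CliqueIn (AddEdge G u v) S → ¬ Both S → IsClique G S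
      clique-old S c nb x y x∈ y∈ ne with c x y x∈ y∈ ne
      ... | inj₁ a                    = a
      ... | inj₂ (inj₁ (refl , refl)) = ⊥-elim (nb (x∈ , y∈))
      ... | inj₂ (inj₂ (refl , refl)) = ⊥-elim (nb (y∈ , x∈))

    -- Deleting one end of the new edge turns A into a clique of G. Size r + 1 then leaves an
    -- r-clique; size p + 2 leaves p common neighbours once both ends are gone.
    NewClique : Fin n → Fin n → Set
    NewClique u v = ∃ λ A → CliqueIn (AddEdge G u v) A × u ∈ A × v ∈ A × suc r ≤ ∣ A ∣ × (¬ Covered G v → suc (suc p) ≤ ∣ A ∣)

    -- Both ends of the new edge must lie in a common pair of consecutive layers, for otherwise the
    -- copy is already in G. That pair is the clique sought: it has at least p + 2 vertices except
    -- for the r + 1 in the second pair of the first chain and the bridge of the third chain, and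
    -- the latter is impossible at an uncovered u.
    newClique : ∀ u v → u ≢ v → ¬ Adj G u v → ¬ Covered G u → NewClique u v
    newClique u v u≢v na ¬cu with sat u v u≢v na
    ... | i , copy = find i (copy⇒layers (sizes i) copy)
      where
      E = AddEdge G u v

      new : ∀ A → CliqueIn E A → Both u v A → suc (suc p) ≤ ∣ A ∣ → NewClique u v
      new A c (u∈ , v∈) h = A , c , u∈ , v∈ , ≤-trans r+1≤p+2 h , λ _ → h

      covered-old : ∀ {x} S → CliqueIn E S → ¬ Both u v S → q ≤ ∣ S ∣ → x ∈ S → Covered G x
      covered-old S c nb = covers G (clique-old u v S c nb)

      oldLayers : ∀ {a b c} (L : Layers (a ∷ b ∷ c ∷ 0 ∷ []) E) →
        ¬ Both u v (Layers.pair L 0) → ¬ Both u v (Layers.pair L 1) → Layers (a ∷ b ∷ c ∷ 0 ∷ []) (Adj G)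
      oldLayers L n₀ n₁ = threeLayers (layer 0) (layer 1) (layer 2) (large 0) (large 1) (large 2)
        (apart (λ ())) (apart (λ ())) (apart (λ ()))
        (clique-old u v _ (pair-clique 0) n₀) (clique-old u v _ (pair-clique 1) n₁)
        where open Layers L

      -- If both ends of the new edge lie in the third layer, one of them can be dropped.
      not-both-top : (L : Layers (sizes zero) E) → ¬ Both u v (Layers.pair L 0) → ¬ Both u v (Layers.layer L 2)
      not-both-top L n₀ (u∈ , v∈) = free zero (layers⇒copy (sizes zero)
        (threeLayers (layer 0) (layer 1) ⁅ u ⁆ (large 0) (large 1) (≤-reflexive (sym (∣⁅x⁆∣≡1 u)))
          (apart (λ ())) (λ a b → apart (λ ()) a (⁅x⁆⊆ u∈ b)) (λ a b → apart (λ ()) a (⁅x⁆⊆ u∈ b))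
          (clique-old u v _ (pair-clique 0) n₀)
          (clique-old u v _ (clique-⊆ {E = E} {T = pair 1}
            (∪-⊆ {S = layer 1} {⁅ u ⁆} (p⊆p∪q _) (⁅x⁆⊆ (q⊆p∪q (layer 1) _ u∈))) (pair-clique 1)) lone)))
        where
        open Layers L
        lone : ¬ Both u v (layer 1 ∪ ⁅ u ⁆)
        lone (_ , v∈′) = [ (λ a → apart (λ ()) a v∈) , (λ b → u≢v (sym (x∈⁅y⁆⇒x≡y u b))) ]′ (x∈p∪q⁻ (layer 1) ⁅ u ⁆ v∈′)

      find : ∀ i → Layers (sizes i) E → NewClique u v
      find zero L with both? u v (Layers.pair L 0) | both? u v (Layers.pair L 1)
      ... | yes b | _ = new _ (Layers.pair-clique L 0) b (≤-trans p+2≤q (≤-trans (≤-reflexive (sym (+-suc p r′))) (Layers.pair-large L 0)))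
      ... | no n₀ | no n₁ = ⊥-elim (free zero (layers⇒copy (sizes zero) (oldLayers L n₀ n₁)))
      ... | no n₀ | yes (u∈ , v∈) = pair 1 , pair-clique 1 , u∈ , v∈ ,
              ≤-trans (≤-reflexive (+-comm 1 r)) (pair-large 1) , λ ¬cv → ⊥-elim (not-both-top L n₀ (top ¬cu u∈ , top ¬cv v∈))
        where
        open Layers L
        -- The first pair avoids the new edge, so it is a clique of G with at least q vertices and
        -- covers all of layer 1.
        top : ∀ {x} → ¬ Covered G x → x ∈ pair 1 → x ∈ layer 2
        top ¬c x∈ = [ (λ a → ⊥-elim (¬c (covered-old (pair 0) (pair-clique 0) n₀
                        (≤-trans (≤-reflexive (sym (+-suc p r′))) (pair-large 0)) (q⊆p∪q (layer 0) _ a)))) , id ]′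
                    (x∈p∪q⁻ (layer 1) (layer 2) x∈)
      find (suc zero) L with both? u v (Layers.pair L 0) | both? u v (Layers.pair L 1)
      ... | yes b | _     = new _ (Layers.pair-clique L 0) b (≤-trans p+2≤q (≤-trans (≤-reflexive (+-comm 1 (p + r′))) (Layers.pair-large L 0)))
      ... | no n₀ | no n₁ = ⊥-elim (free (suc zero) (layers⇒copy (sizes (suc zero)) (oldLayers L n₀ n₁)))
      ... | no n₀ | yes b = new _ (Layers.pair-clique L 1) b (Layers.pair-large L 1)
      find (suc (suc zero)) L with both? u v (Layers.pair L 0) | both? u v (Layers.pair L 1) | both? u v (Layers.pair L 2)
      ... | yes b | _     | _     = new _ (Layers.pair-clique L 0) b (≤-trans p+2≤q (≤-trans (≤-reflexive (+-comm 1 (p + r′))) (Layers.pair-large L 0)))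
      ... | no _  | _     | yes b = new _ (Layers.pair-clique L 2) b (≤-trans p+2≤q (Layers.pair-large L 2))
      -- With the new edge as bridge, both outer pairs are old cliques of at least q vertices, and u
      -- lies in one of them.
      ... | no n₀ | yes (u∈ , _) | no n₂ = ⊥-elim (¬cu
              ([ (λ a → covered-old (pair 0) (pair-clique 0) n₀ (≤-trans (≤-reflexive (+-comm 1 (p + r′))) (pair-large 0)) (q⊆p∪q (layer 0) _ a))
               , (λ b → covered-old (pair 2) (pair-clique 2) n₂ (pair-large 2) (p⊆p∪q (layer 3) b)) ]′
               (x∈p∪q⁻ (layer 1) (layer 2) u∈)))
        where open Layers L
      ... | no n₀ | no n₁ | no n₂ = ⊥-elim (free (suc (suc zero)) (layers⇒copy (sizes (suc (suc zero)))
              (fourLayers (layer 0) (layer 1) (layer 2) (layer 3) (large 0) (large 1) (large 2) (large 3)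
                (apart (λ ())) (apart (λ ())) (apart (λ ())) (apart (λ ())) (apart (λ ())) (apart (λ ()))
                (clique-old u v _ (pair-clique 0) n₀) (clique-old u v _ (pair-clique 1) n₁) (clique-old u v _ (pair-clique 2) n₂))))
        where open Layers L

    OutClique : Subset n → Set
    OutClique S = (∣ S ∣ ≡ r × IsClique G S) × (∀ Q → QClique G Q → ¬ (S ⊆ Q))

    rClique : ∀ {A a b} → IsClique G A → r ≤ ∣ A ∣ → a ∈ A → b ∈ A →
              ∃ λ S → (∣ S ∣ ≡ r × IsClique G S) × a ∈ S × b ∈ S × S ⊆ A
    rClique {A} {a} {b} c h a∈ b∈ =
      let S , i , j , e = intermediate (⁅ a ⁆ ∪ ⁅ b ⁆) A r (∪-⊆ {S = ⁅ a ⁆} {⁅ b ⁆} (⁅x⁆⊆ a∈) (⁅x⁆⊆ b∈))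
                            (≤-trans (∣p∪q∣≤∣p∣+∣q∣ ⁅ a ⁆ ⁅ b ⁆) (≤-trans (≤-reflexive (cong₂ _+_ (∣⁅x⁆∣≡1 a) (∣⁅x⁆∣≡1 b))) (m≤n⇒m≤1+n 2≤r′))) h
      in S , (e , clique-⊆ {E = Adj G} {S} {A} j c) , i (p⊆p∪q _ (x∈⁅x⁆ a)) , i (q⊆p∪q ⁅ a ⁆ _ (x∈⁅x⁆ b)) , j

    uncovered⇒out : ∀ {u S} → ¬ Covered G u → ∣ S ∣ ≡ r × IsClique G S → u ∈ S → OutClique S
    uncovered⇒out ¬cu c u∈ = c , λ Q qc i → ¬cu (Q , qc , i u∈)

    old-without : ∀ {u v A} → CliqueIn (AddEdge G u v) A → IsClique G (A - u) × IsClique G (A - v)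
    old-without {u} {v} {A} c =
      clique-old u v (A - u) (clique-⊆ {E = AddEdge G u v} {T = A} (p─q⊆p A _) c) (λ (m , _) → x∈p-y⇒x≢y A m refl) ,
      clique-old u v (A - v) (clique-⊆ {E = AddEdge G u v} {T = A} (p─q⊆p A _) c) (λ (_ , m) → x∈p-y⇒x≢y A m refl)

    -- If u misses some x in Q, the clique A created by the edge ux has r + 1 vertices, so dropping
    -- either u or x leaves room for an r-clique of G. Which end is dropped depends on whether A
    -- leaves Q elsewhere than at u.
    attached : ∀ {u Q} → ¬ Covered G u → QClique G Q → ∃ λ S → OutClique S × ∃ λ y → y ∈ S × y ∈ Q
    attached {u} {Q} ¬cu qc@(e , c) with all? (λ x → (x ∈? Q) →-dec adj? G u x)
    ... | yes full =
      let x , x∈ = ∣p∣>0⇒Nonempty Q (≤-trans (s≤s z≤n) (≤-reflexive (sym e)))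
          S , rc , u∈S , x∈S , _ = rClique {Q ∪ ⁅ u ⁆} {u} {x} (clique-insert G c (λ x m _ → full x m))
             (≤-trans (s≤s (m≤n+m r′ p)) (≤-trans (≤-reflexive (sym e)) (∣p∣≤∣p∪q∣ Q ⁅ u ⁆)))
             (q⊆p∪q Q _ (x∈⁅x⁆ u)) (p⊆p∪q _ x∈)
      in S , uncovered⇒out ¬cu rc u∈S , x , x∈S , x∈
    ... | no ¬full = meet (¬∀⟶∃¬ n _ (λ x → (x ∈? Q) →-dec adj? G u x) ¬full)
      where
      meet : (∃ λ x → ¬ (x ∈ Q → Adj G u x)) → ∃ λ S → OutClique S × ∃ λ y → y ∈ S × y ∈ Q
      meet (x , h) with x ∈? Q
      ... | no x∉ = ⊥-elim (h (⊥-elim ∘ x∉))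
      ... | yes x∈ with newClique u x (λ { refl → ¬cu (Q , qc , x∈) }) (λ a → h (λ _ → a)) ¬cu
      ... | A , cA , u∈A , x∈A , big , _ with all? (λ z → (z ∈? (A - u)) →-dec (z ∈? Q))
      -- Drop x: the r-clique keeps the uncovered u, so no q-clique contains it, and a third vertex
      -- y of A, available since r ≥ 3, provides the contact with Q.
      ... | yes inQ =
        let y , y∈ = ∣p∣>0⇒Nonempty (A - u - x) (s≤s⁻¹ (s≤s⁻¹ (≤-trans (s≤s (s≤s (≤-trans (s≤s z≤n) 2≤r′))) (≤-trans big
                       (≤-trans (∣p∣≤1+∣p-x∣ A u) (s≤s (∣p∣≤1+∣p-x∣ (A - u) x)))))))
            y∈A-u = p─q⊆p (A - u) _ y∈
            S , rc , u∈S , y∈S , _ = rClique {A - x} {u} {y} (proj₂ (old-without cA)) (s≤s⁻¹ (≤-trans big (∣p∣≤1+∣p-x∣ A x)))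
               (x∈p∧x≢y⇒x∈p-y u∈A (λ { refl → ¬cu (Q , qc , x∈) })) (x∈p∧x≢y⇒x∈p-y (p─q⊆p A _ y∈A-u) (x∈p-y⇒x≢y (A - u) y∈))
        in S , uncovered⇒out ¬cu rc u∈S , y , y∈S , inQ y y∈A-u
      ... | no ¬inQ with ¬∀⟶∃¬ n _ (λ z → (z ∈? (A - u)) →-dec (z ∈? Q)) ¬inQ
      ... | z , k with z ∈? (A - u)
      ... | no z∉ = ⊥-elim (k (⊥-elim ∘ z∉))
      -- Drop u: a q-clique containing the r-clique would contain x, hence lie in Q by
      -- `qclique-unique`, but z is outside Q.
      ... | yes z∈ =
        let S , rc , x∈S , z∈S , _ = rClique {A - u} {x} {z} (proj₁ (old-without cA)) (s≤s⁻¹ (≤-trans big (∣p∣≤1+∣p-x∣ A u)))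
               (x∈p∧x≢y⇒x∈p-y x∈A (λ { refl → ¬cu (Q , qc , x∈) })) z∈
        in S , (rc , λ Q′ qc′ i → k (λ _ → qclique-unique G free qc qc′ x∈ (i x∈S) (i z∈S))) , x , x∈S , x∈

    -- P is cut from the clique on at least p + 2 vertices created by the edge uv. Only that edge is
    -- new, so P with either end alone is a clique of G.
    commonClique : ∀ {u v} → u ≢ v → ¬ Adj G u v → ¬ Covered G u → ¬ Covered G v →
      ∃ λ P → ∣ P ∣ ≡ p × u ∉ P × IsClique G (P ∪ ⁅ u ⁆) × IsClique G (P ∪ ⁅ v ⁆)
    commonClique {u} {v} u≢v na ¬cu ¬cv =
      let A , cA , u∈ , v∈ , _ , big = newClique u v u≢v na ¬cu
          P , _ , i , e = intermediate ⊥ (A - u - v) p ⊥⊆ (≤-trans (≤-reflexive (∣⊥∣≡0 n)) z≤n)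
            (s≤s⁻¹ (s≤s⁻¹ (≤-trans (big ¬cv) (≤-trans (∣p∣≤1+∣p-x∣ A u) (s≤s (∣p∣≤1+∣p-x∣ (A - u) v))))))
          P⊆A-u : P ⊆ A - u
          P⊆A-u = p─q⊆p (A - u) _ ∘ i
          P⊆A-v : P ⊆ A - v
          P⊆A-v m = x∈p∧x≢y⇒x∈p-y (p─q⊆p A _ (P⊆A-u m)) (x∈p-y⇒x≢y (A - u) (i m))
      in P , e , (λ m → x∈p-y⇒x≢y A (P⊆A-u m) refl) ,
         clique-⊆ {E = Adj G} {T = A - v} (∪-⊆ {S = P} {⁅ u ⁆} P⊆A-v (⁅x⁆⊆ (x∈p∧x≢y⇒x∈p-y u∈ u≢v))) (proj₂ (old-without cA)) ,
         clique-⊆ {E = Adj G} {T = A - u} (∪-⊆ {S = P} {⁅ v ⁆} P⊆A-u (⁅x⁆⊆ (x∈p∧x≢y⇒x∈p-y v∈ (u≢v ∘ sym)))) (proj₁ (old-without cA))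

-- Double counting of pairs (x, S) with x in S; the degree sums below all pass through this
-- identity.
∑-incidences : ∀ {n a} {P : Subset n → Set a} (P? : ∀ S → Dec (P S)) r → (∀ S → P S → ∣ S ∣ ≡ r) →
  ∑ (allFin n) (λ x → ∑ (allSubsets n) (λ S → ⟦ x ∈? S ⟧ * ⟦ P? S ⟧)) ≡ r * ∑ (allSubsets n) (λ S → ⟦ P? S ⟧)
∑-incidences {n} P? r h = begin
  ∑ (allFin n) (λ x → ∑ (allSubsets n) (λ S → ⟦ x ∈? S ⟧ * ⟦ P? S ⟧)) ≡⟨ ∑-swap (allFin n) (allSubsets n) _ ⟩
  ∑ (allSubsets n) (λ S → ∑ (allFin n) (λ x → ⟦ x ∈? S ⟧ * ⟦ P? S ⟧)) ≡⟨ ∑-cong (allSubsets n) inner ⟩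
  ∑ (allSubsets n) (λ S → r * ⟦ P? S ⟧)                             ≡⟨ ∑-* (allSubsets n) r _ ⟩
  r * ∑ (allSubsets n) (λ S → ⟦ P? S ⟧)                             ∎
  where
  open ≡-Reasoning
  weight : ∀ S (d : Dec _) → ∣ S ∣ * ⟦ d ⟧ ≡ r * ⟦ d ⟧
  weight S (yes p) = cong (_* 1) (h S p)
  weight S (no _)  = trans (*-zeroʳ ∣ S ∣) (sym (*-zeroʳ r))
  inner : ∀ S → ∑ (allFin n) (λ x → ⟦ x ∈? S ⟧ * ⟦ P? S ⟧) ≡ r * ⟦ P? S ⟧
  inner S = begin
    ∑ (allFin n) (λ x → ⟦ x ∈? S ⟧ * ⟦ P? S ⟧) ≡⟨ ∑-cong (allFin n) (λ x → *-comm ⟦ x ∈? S ⟧ _) ⟩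
    ∑ (allFin n) (λ x → ⟦ P? S ⟧ * ⟦ x ∈? S ⟧) ≡⟨ ∑-* (allFin n) ⟦ P? S ⟧ _ ⟩
    ⟦ P? S ⟧ * ∑ (allFin n) (λ x → ⟦ x ∈? S ⟧) ≡⟨ cong (⟦ P? S ⟧ *_) (∑-∈ S) ⟩
    ⟦ P? S ⟧ * ∣ S ∣                           ≡⟨ *-comm ⟦ P? S ⟧ ∣ S ∣ ⟩
    ∣ S ∣ * ⟦ P? S ⟧                           ≡⟨ weight S (P? S) ⟩
    r * ⟦ P? S ⟧                               ∎

-- The upper bound: disjoint copies of K_q

module Blocks (r′ p : ℕ) where
  open Family r′ p public

  pair₀-size : ∀ i → q ≤ size (sizes i) 0 + size (sizes i) 1
  pair₀-size zero             = ≤-reflexive (sym (+-suc p r′))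
  pair₀-size (suc zero)       = ≤-reflexive (+-comm 1 (p + r′))
  pair₀-size (suc (suc zero)) = ≤-reflexive (+-comm 1 (p + r′))

  size₁>0 : ∀ i → 1 ≤ size (sizes i) 1
  size₁>0 zero             = s≤s z≤n
  size₁>0 (suc zero)       = ≤-refl
  size₁>0 (suc (suc zero)) = ≤-refl

  size₂>0 : ∀ i → 1 ≤ size (sizes i) 2
  size₂>0 zero             = ≤-refl
  size₂>0 (suc zero)       = s≤s z≤n
  size₂>0 (suc (suc zero)) = ≤-refl

  module Ends {n} {E : Fin n → Fin n → Set} i (L : Layers (sizes i) E) where
    open Layers L
    ne₁ : Nonempty (layer 1)
    ne₁ = ∣p∣>0⇒Nonempty (layer 1) (≤-trans (size₁>0 i) (large 1))
    ne₂ : Nonempty (layer 2)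
    ne₂ = ∣p∣>0⇒Nonempty (layer 2) (≤-trans (size₂>0 i) (large 2))
    y z : Fin n
    y = proj₁ ne₁
    z = proj₁ ne₂
    y≢z : y ≢ z
    y≢z e = apart {1} {2} (λ ()) (proj₂ ne₁) (subst (_∈ layer 2) (sym e) (proj₂ ne₂))

  edgeless-free : ∀ {n} → FreeOf {n} (λ _ _ → Absurd)
  edgeless-free i c = joined {1} {2} (s≤s z≤n , ≤-refl) (proj₂ ne₁) (proj₂ ne₂) y≢z
    where
    L = copy⇒layers (sizes i) c
    open Layers L
    open Ends i L

  module _ (k : ℕ) where

    blk : Fin (k * q) → Fin k
    blk x = proj₁ (remQuot {k} q x)

    SameBlock : Fin (k * q) → Fin (k * q) → Set
    SameBlock x y = x ≢ y × blk x ≡ blk y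

    sameBlock? : ∀ x y → Dec (SameBlock x y)
    sameBlock? x y = ¬? (x ≟ᶠ y) ×-dec (blk x ≟ᶠ blk y)

    blockGraph : SimpleGraph (k * q)
    blockGraph = record
      { adj    = λ x y → does (sameBlock? x y)
      ; sym    = λ x y → does-⇔ (mk⇔ flip′ flip′) (sameBlock? x y) (sameBlock? y x)
      ; irrefl = λ x → dec-false (sameBlock? x x) (λ (ne , _) → ne refl) }
      where
      flip′ : ∀ {x y} → SameBlock x y → SameBlock y x
      flip′ (ne , e) = ne ∘ sym , sym e

    same : ∀ x y → x ≢ y → Adj blockGraph x y → blk x ≡ blk y
    same x y _ a = proj₂ (does⁻ (sameBlock? x y) a)

    inBlock? : ∀ b x → Dec (blk x ≡ b)
    inBlock? b x = blk x ≟ᶠ b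

    block : Fin k → Subset (k * q)
    block b = select (inBlock? b)

    ∣block∣ : ∀ b → ∣ block b ∣ ≡ q
    ∣block∣ b = ≤-antisym upper
      (injection⇒≤∣∣ q (combine b) (block b) (λ {i} {j} e → combine-injectiveʳ b i b j e)
        (λ i → ∈-select⁺ (inBlock? b) (cong proj₁ (remQuot-combine b i))))
      where
      enum = ≤∣∣⇒injection ∣ block b ∣ (block b) ≤-refl
      g = proj₁ enum
      in-b : ∀ i → blk (g i) ≡ b
      in-b i = ∈-select⁻ (inBlock? b) (proj₂ (proj₂ enum) i)
      rest : Fin ∣ block b ∣ → Fin q
      rest i = proj₂ (remQuot {k} q (g i))
      upper : ∣ block b ∣ ≤ q
      upper = injective⇒≤ {f = rest} (λ {i} {j} e → proj₁ (proj₂ enum)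
        (trans (sym (combine-remQuot {k} q (g i))) (trans (cong₂ combine (trans (in-b i) (sym (in-b j))) e) (combine-remQuot {k} q (g j)))))

    block-clique : ∀ b → IsClique blockGraph (block b)
    block-clique b x y x∈ y∈ ne = dec-true (sameBlock? x y)
      (ne , trans (∈-select⁻ (inBlock? b) x∈) (sym (∈-select⁻ (inBlock? b) y∈)))

    ∈-block : ∀ x → x ∈ block (blk x)
    ∈-block x = ∈-select⁺ (inBlock? (blk x)) refl

    clique⊆block : ∀ {S x} → IsClique blockGraph S → x ∈ S → S ⊆ block (blk x)
    clique⊆block {S} {x} c x∈ {y} y∈ with y ≟ᶠ x
    ... | yes refl = ∈-block x
    ... | no ne    = ∈-select⁺ (inBlock? (blk x)) (same y x ne (c y x y∈ x∈ ne))

    -- A copy would put the q + 1 vertices of its first two layers and of z into one block.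
    block-free : FreeOf (Adj blockGraph)
    block-free i copy = 1+n≰n (begin
      suc q                     ≤⟨ s≤s (≤-trans (pair₀-size i) (pair-large 0)) ⟩
      suc ∣ pair 0 ∣            ≡⟨ +-comm 1 ∣ pair 0 ∣ ⟩
      ∣ pair 0 ∣ + 1            ≡⟨ cong (∣ pair 0 ∣ +_) (∣⁅x⁆∣≡1 z) ⟨
      ∣ pair 0 ∣ + ∣ ⁅ z ⁆ ∣    ≤⟨ disjoint⇒∣p∣+∣q∣≤∣p∪q∣ (pair 0) ⁅ z ⁆ z-new ⟩
      ∣ pair 0 ∪ ⁅ z ⁆ ∣        ≤⟨ p⊆q⇒∣p∣≤∣q∣ (∪-⊆ {S = pair 0} {⁅ z ⁆} (clique⊆block (pair-clique 0) y∈) (⁅x⁆⊆ z∈)) ⟩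
      ∣ block (blk y) ∣         ≡⟨ ∣block∣ (blk y) ⟩
      q                         ∎)
      where
      open ≤-Reasoning
      L = copy⇒layers (sizes i) copy
      open Layers L
      open Ends i L
      y∈ : y ∈ pair 0
      y∈ = q⊆p∪q (layer 0) _ (proj₂ ne₁)
      z∈ : z ∈ block (blk y)
      z∈ = clique⊆block (pair-clique 1) (p⊆p∪q _ (proj₂ ne₁)) (q⊆p∪q (layer 1) _ (proj₂ ne₂))
      z-new : ∀ {x} → x ∈ pair 0 → x ∉ ⁅ z ⁆
      z-new x∈ x∈z with refl ← x∈⁅y⁆⇒x≡y z x∈z =
        [ (λ a → apart {0} {2} (λ ()) a (proj₂ ne₂)) , (λ a → apart {1} {2} (λ ()) a (proj₂ ne₂)) ]′ (x∈p∪q⁻ (layer 0) (layer 1) x∈)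

    -- Non-adjacent vertices lie in different blocks, and the new edge is the bridge of the third
    -- chain, with u and v as its two middle layers.
    block-saturated : ∀ u v → u ≢ v → ¬ Adj blockGraph u v → ∃ λ i → CopyIn (chain (sizes i)) (AddEdge blockGraph u v)
    block-saturated u v u≢v na = suc (suc zero) , layers⇒copy (sizes (suc (suc zero)))
      (fourLayers (U - u) ⁅ u ⁆ ⁅ v ⁆ (V - v)
        (rest u) (≤-reflexive (sym (∣⁅x⁆∣≡1 u))) (≤-reflexive (sym (∣⁅x⁆∣≡1 v))) (rest v)
        (x∈p─q⇒x∉q U ⁅ u ⁆) (λ a b → U∩V (p─q⊆p U _ a) (⁅x⁆⊆ (∈-block v) b)) (λ a b → U∩V (p─q⊆p U _ a) (p─q⊆p V _ b))
        (λ a b → U∩V (⁅x⁆⊆ (∈-block u) a) (⁅x⁆⊆ (∈-block v) b)) (λ a b → U∩V (⁅x⁆⊆ (∈-block u) a) (p─q⊆p V _ b))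
        (λ a b → x∈p─q⇒x∉q V ⁅ v ⁆ b a)
        (λ x y a b ne → inj₁ (clique-⊆ {E = Adj blockGraph} {T = U} (∪-⊆ {S = U - u} {⁅ u ⁆} (p─q⊆p U _) (⁅x⁆⊆ (∈-block u))) (block-clique _) x y a b ne))
        bridge
        (λ x y a b ne → inj₁ (clique-⊆ {E = Adj blockGraph} {T = V} (∪-⊆ {S = ⁅ v ⁆} {V - v} (⁅x⁆⊆ (∈-block v)) (p─q⊆p V _)) (block-clique _) x y a b ne)))
      where
      U = block (blk u)
      V = block (blk v)
      rest : ∀ x → p + r′ ≤ ∣ block (blk x) - x ∣
      rest x = s≤s⁻¹ (≤-trans (≤-reflexive (sym (∣block∣ (blk x)))) (∣p∣≤1+∣p-x∣ (block (blk x)) x))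
      U∩V : ∀ {x} → x ∈ U → x ∉ V
      U∩V a b = na (dec-true (sameBlock? u v) (u≢v , trans (sym (∈-select⁻ (inBlock? (blk u)) a)) (∈-select⁻ (inBlock? (blk v)) b)))
      bridge : CliqueIn (AddEdge blockGraph u v) (⁅ u ⁆ ∪ ⁅ v ⁆)
      bridge x y a b ne with x∈p∪q⁻ ⁅ u ⁆ ⁅ v ⁆ a | x∈p∪q⁻ ⁅ u ⁆ ⁅ v ⁆ b
      ... | inj₁ c | inj₁ d = ⊥-elim (ne (trans (x∈⁅y⁆⇒x≡y u c) (sym (x∈⁅y⁆⇒x≡y u d))))
      ... | inj₁ c | inj₂ d = inj₂ (inj₁ (x∈⁅y⁆⇒x≡y u c , x∈⁅y⁆⇒x≡y v d))
      ... | inj₂ c | inj₁ d = inj₂ (inj₂ (x∈⁅y⁆⇒x≡y v c , x∈⁅y⁆⇒x≡y u d))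
      ... | inj₂ c | inj₂ d = ⊥-elim (ne (trans (x∈⁅y⁆⇒x≡y v c) (sym (x∈⁅y⁆⇒x≡y v d))))

    -- A clique through x stays in the block of x, which bounds the degree of x by c₁; the factor r
    -- from counting incidences is kept on the left to avoid division.
    block-copies : r * copiesK blockGraph r ≤ ((p + r′) C r′) * (k * q)
    block-copies = begin
      r * copiesK blockGraph r                                        ≡⟨ cong (r *_) (copiesK-∑ blockGraph r) ⟩
      r * ∑ (allSubsets (k * q)) (λ S → ⟦ K? S ⟧)                      ≡⟨ ∑-incidences K? r (λ S → proj₁) ⟨
      ∑ (allFin (k * q)) (λ x → ∑ (allSubsets (k * q)) (λ S → ⟦ x ∈? S ⟧ * ⟦ K? S ⟧)) ≤⟨ ∑-mono (allFin (k * q)) degree ⟩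
      ∑ (allFin (k * q)) (λ x → ((p + r′) C r′) * 1)                  ≡⟨ ∑-* (allFin (k * q)) ((p + r′) C r′) (λ _ → 1) ⟩
      ((p + r′) C r′) * ∑ (allFin (k * q)) (λ _ → 1)                  ≡⟨ cong (((p + r′) C r′) *_) (∑-one (k * q)) ⟩
      ((p + r′) C r′) * (k * q)                                       ∎
      where
      open ≤-Reasoning
      K? : ∀ S → Dec (∣ S ∣ ≡ r × IsClique blockGraph S)
      K? S = (∣ S ∣ ≟ r) ×-dec isClique? blockGraph S
      degree : ∀ x → ∑ (allSubsets (k * q)) (λ S → ⟦ x ∈? S ⟧ * ⟦ K? S ⟧) ≤ ((p + r′) C r′) * 1
      degree x = begin
        ∑ (allSubsets (k * q)) (λ S → ⟦ x ∈? S ⟧ * ⟦ K? S ⟧)            ≤⟨ ∑-mono (allSubsets (k * q)) (λ S → ≤-trans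
            (≤-reflexive (sym (⟦⟧-× (x ∈? S) (K? S))))
            (⟦⟧-mono ((x ∈? S) ×-dec K? S) (pointedIn? x (block (blk x)) r S) (λ (x∈ , e , c) → x∈ , (λ {y} → clique⊆block {S} {x} c x∈ {y}) , e))) ⟩
        ∑ (allSubsets (k * q)) (λ S → ⟦ pointedIn? x (block (blk x)) r S ⟧) ≡⟨ countPointed x (block (blk x)) (p + r′) r′ (∈-block x) (∣block∣ (blk x)) ⟩
        (p + r′) C r′                                                 ≡⟨ *-identityʳ _ ⟨
        ((p + r′) C r′) * 1                                           ∎

-- The families

Iso⇒≡ : ∀ {G H} → Iso G H → order G ≡ order H
Iso⇒≡ {graph m G} {graph n H} (f , g , gf , fg , _) = ≤-antisym
  (injective⇒≤ {f = f} (λ {x} {y} e → trans (sym (gf x)) (trans (cong g e) (gf y))))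
  (injective⇒≤ {f = g} (λ {x} {y} e → trans (sym (fg x)) (trans (cong f e) (fg y))))

module Distinct (r″ : ℕ) where

  module _ (p : ℕ) where
    open Family (suc r″) p

    order₀ : sum (sizes zero) ≡ suc (suc (p + suc r″))
    order₀ = solve 2 (λ p s → p :+ ((con 2 :+ s) :+ con 1) := con 2 :+ (p :+ (con 1 :+ s))) refl p r″
      where open +-*-Solver

    order₁ : sum (sizes (suc zero)) ≡ suc (suc (p + suc r″)) + p
    order₁ = solve 2 (λ p s → (p :+ (con 1 :+ s)) :+ (con 1 :+ ((con 1 :+ p) :+ con 0)) := con 2 :+ (p :+ (con 1 :+ s)) :+ p) refl p r″
      where open +-*-Solver

    order₂ : sum (sizes (suc (suc zero))) ≡ suc (suc (p + suc r″)) + p + suc r″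
    order₂ = solve 2 (λ p s → (p :+ (con 1 :+ s)) :+ (con 1 :+ (con 1 :+ ((p :+ (con 1 :+ s)) :+ con 0))) := con 2 :+ (p :+ (con 1 :+ s)) :+ p :+ (con 1 :+ s)) refl p r″
      where open +-*-Solver

    order≤ : ∀ j → sum (sizes j) ≤ sum (sizes (suc (suc zero)))
    order≤ zero rewrite order₀ | order₂ = ≤-trans (m≤m+n _ p) (m≤m+n _ (suc r″))
    order≤ (suc zero) rewrite order₁ | order₂ = m≤m+n _ (suc r″)
    order≤ (suc (suc zero)) = ≤-refl

  orders-differ : ∀ p i j → i ≢ j → sum (Family.sizes (suc r″) (suc p) i) ≢ sum (Family.sizes (suc r″) (suc p) j)
  orders-differ p zero zero ne e = ne refl
  orders-differ p zero (suc zero) ne e = m≢1+m+n _ (trans (sym (order₀ (suc p))) (trans e (trans (order₁ (suc p)) (+-suc _ p))))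
  orders-differ p zero (suc (suc zero)) ne e = m≢1+m+n _ (trans (sym (order₀ (suc p))) (trans e (trans (order₂ (suc p)) (trans (+-assoc (suc (suc (suc p + suc r″))) (suc p) (suc r″)) (+-suc _ (p + suc r″))))))
  orders-differ p (suc zero) (suc zero) ne e = ne refl
  orders-differ p (suc zero) (suc (suc zero)) ne e = m≢1+m+n _ (trans (sym (order₁ (suc p))) (trans e (trans (order₂ (suc p)) (+-suc _ r″))))
  orders-differ p (suc (suc zero)) (suc (suc zero)) ne e = ne refl
  orders-differ p (suc zero) zero ne e = orders-differ p zero (suc zero) (ne ∘ sym) (sym e)
  orders-differ p (suc (suc zero)) zero ne e = orders-differ p zero (suc (suc zero)) (ne ∘ sym) (sym e)
  orders-differ p (suc (suc zero)) (suc zero) ne e = orders-differ p (suc zero) (suc (suc zero)) (ne ∘ sym) (sym e)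

  -- The parameter is shifted to `suc p` because the first two orders differ by exactly the
  -- parameter; the last two differ by r - 1.
  family : ℕ → Family3
  family p = record
    { member   = λ i → chain (Family.sizes (suc r″) (suc p) i)
    ; distinct = λ i j ne iso → orders-differ p i j ne (Iso⇒≡ {chain (Family.sizes (suc r″) (suc p) i)} {chain (Family.sizes (suc r″) (suc p) j)} iso) }

  -- The third chain has the largest order in its family, and isomorphism preserves orders. As this
  -- maximum grows strictly with p, it identifies p.
  order-mono : ∀ {p p′} → SameFamily (family p) (family p′) →
    sum (Family.sizes (suc r″) (suc p) (suc (suc zero))) ≤ sum (Family.sizes (suc r″) (suc p′) (suc (suc zero)))
  order-mono {p} {p′} (h , _) =
    let j , iso = h (suc (suc zero))
    in ≤-trans (≤-reflexive (Iso⇒≡ {member (family p) (suc (suc zero))} {member (family p′) j} iso)) (order≤ (suc p′) j)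

  order₂-injective : ∀ p p′ → sum (Family.sizes (suc r″) (suc p) (suc (suc zero))) ≤ sum (Family.sizes (suc r″) (suc p′) (suc (suc zero))) → p ≤ p′
  order₂-injective p p′ h = ≮⇒≥ (λ p′<p → <⇒≱ (o< p′<p) h)
    where
    o< : p′ < p → sum (Family.sizes (suc r″) (suc p′) (suc (suc zero))) < sum (Family.sizes (suc r″) (suc p) (suc (suc zero)))
    o< lt rewrite order₂ (suc p) | order₂ (suc p′) =
      +-monoˡ-< (suc r″) (+-mono-< (s≤s (s≤s (s≤s (+-monoˡ-< (suc r″) lt)))) (s≤s lt))

  sameFamily⇒≡ : ∀ {p p′} → SameFamily (family p) (family p′) → p ≡ p′
  sameFamily⇒≡ {p} {p′} s@(h , k) = ≤-antisym (order₂-injective p p′ (order-mono {p} {p′} s)) (order₂-injective p′ p (order-mono {p′} {p} (k , h)))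

-- Preparations for the lower bound: greedy cliques and the final inequality

maximalClique : ∀ {n} (G : SimpleGraph n) {P : Fin n → Set} (P? : ∀ x → Dec (P x)) →
  ∃ λ K → IsClique G K × (∀ {x} → x ∈ K → P x) × (∀ u → P u → u ∉ K → ∃ λ w → w ∈ K × ¬ Adj G u w)
maximalClique {n} G {P} P? = extend n ⊥ (m≤m+n n _) (λ x y x∈ → ⊥-elim (∉⊥ x∈)) (⊥-elim ∘ ∉⊥)
  where
  Result : Set
  Result = ∃ λ K → IsClique G K × (∀ {x} → x ∈ K → P x) × (∀ u → P u → u ∉ K → ∃ λ w → w ∈ K × ¬ Adj G u w)
  extend : ∀ fuel K → n ≤ fuel + ∣ K ∣ → IsClique G K → (∀ {x} → x ∈ K → P x) → Result
  extend fuel K bound c h with any? (λ u → P? u ×-dec (¬? (u ∈? K) ×-dec all? (λ w → (w ∈? K) →-dec adj? G u w)))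
  ... | no none = K , c , h , λ u pu u∉ → blocked u pu u∉
    where
    blocked : ∀ u → P u → u ∉ K → ∃ λ w → w ∈ K × ¬ Adj G u w
    blocked u pu u∉ with ¬∀⟶∃¬ n _ (λ w → (w ∈? K) →-dec adj? G u w) (λ all → none (u , pu , u∉ , all))
    ... | w , k with w ∈? K
    ...   | yes w∈ = w , w∈ , λ a → k (λ _ → a)
    ...   | no w∉  = ⊥-elim (k (⊥-elim ∘ w∉))
  ... | yes (u , pu , u∉ , all) = next fuel bound
    where
    K⁺ = K ∪ ⁅ u ⁆
    K<K⁺ : ∣ K ∣ < ∣ K⁺ ∣
    K<K⁺ = p⊂q⇒∣p∣<∣q∣ (p⊆p∪q _ , u , q⊆p∪q K _ (x∈⁅x⁆ u) , u∉)
    next : ∀ fuel → n ≤ fuel + ∣ K ∣ → Result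
    next zero    b = ⊥-elim (1+n≰n (≤-trans K<K⁺ (≤-trans (∣p∣≤n K⁺) b)))
    next (suc f) b = extend f K⁺ (≤-trans b (≤-trans (≤-reflexive (sym (+-suc f ∣ K ∣))) (+-monoʳ-≤ f K<K⁺)))
      (clique-insert G c (λ x x∈ _ → all x x∈))
      (λ x∈ → [ h , (λ m → subst P (sym (x∈⁅y⁆⇒x≡y u m)) pu) ]′ (x∈p∪q⁻ K ⁅ u ⁆ x∈))

-- Here v, h, l count covered, heavy and light vertices, z and w zone and remote ones, and o the
-- r-cliques in no q-clique. With M = r o, the bounds c₁ h ≤ M/6 and c₁ l ≤ c₁ c + M/2 give c₁ (h +
-- l) ≤ 2M/3 + c₁ c. Of a budget of 16 q M, the uncovered vertices at rate 18 take 12, and the bonus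
-- 2 v takes 2 by v ≤ q M. The gain is 2 n over the slope c₁ / r scaled by 16 q r, up to a constant.
weigh : ∀ {q c₁ r a N o n v h l z w c} → 1 ≤ q → 1 ≤ c₁ → 2 * c₁ ≤ r * a →
  n ≤ v + (h + l) → c₁ * v + r * o ≤ r * N → v ≤ q * (r * o) → 6 * c₁ * h ≤ r * o →
  l ≤ z + w → z ≤ c → a * w ≤ o →
  (16 * (q * c₁) + 2) * n ≤ 16 * (q * r) * N + 18 * (q * c₁) * c
weigh {q} {c₁} {r} {a} {N} {o} {n} {v} {h} {l} {z} {w} {c} 1≤q 1≤c₁ 2c₁≤ra n≤ tot v≤ h≤ l≤ z≤ w≤ = begin
  (16 * X + 2) * n                                        ≤⟨ *-monoʳ-≤ (16 * X + 2) n≤ ⟩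
  (16 * X + 2) * (v + (h + l))                            ≡⟨ solve 3 (λ X v t → (con 16 :* X :+ con 2) :* (v :+ t) := con 16 :* X :* v :+ con 2 :* v :+ (con 16 :* X :+ con 2) :* t) refl X v (h + l) ⟩
  16 * X * v + 2 * v + (16 * X + 2) * (h + l)             ≤⟨ +-mono-≤ (+-monoʳ-≤ (16 * X * v) (*-monoʳ-≤ 2 v≤)) (*-monoˡ-≤ (h + l) 16X+2≤18X) ⟩
  16 * X * v + 2 * (q * M) + 18 * X * (h + l)             ≡⟨ cong (16 * X * v + 2 * (q * M) +_) (solve 4 (λ q c₁ h l → con 18 :* (q :* c₁) :* (h :+ l)
                                                               := (con 3 :* q) :* (con 6 :* c₁ :* h :+ con 3 :* (con 2 :* c₁ :* l))) refl q c₁ h l) ⟩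
  16 * X * v + 2 * (q * M) + 3 * q * (6 * c₁ * h + 3 * (2 * c₁ * l))
                                                          ≤⟨ +-monoʳ-≤ (16 * X * v + 2 * (q * M)) (*-monoʳ-≤ (3 * q) (+-mono-≤ h≤ (*-monoʳ-≤ 3 light-bound))) ⟩
  16 * X * v + 2 * (q * M) + 3 * q * (M + 3 * (2 * c₁ * c + M))
                                                          ≡⟨ solve 5 (λ q c₁ v M c → con 16 :* (q :* c₁) :* v :+ con 2 :* (q :* M) :+ con 3 :* q :* (M :+ con 3 :* (con 2 :* c₁ :* c :+ M))
                                                               := con 16 :* (q :* c₁) :* v :+ con 14 :* (q :* M) :+ con 18 :* (q :* c₁) :* c) refl q c₁ v M c ⟩
  16 * X * v + 14 * (q * M) + 18 * X * c                  ≤⟨ +-monoˡ-≤ (18 * X * c) (+-monoʳ-≤ (16 * X * v) (*-monoˡ-≤ (q * M) (m≤m+n 14 2))) ⟩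
  16 * X * v + 16 * (q * M) + 18 * X * c                  ≡⟨ cong (_+ 18 * X * c) (solve 4 (λ q c₁ v M → con 16 :* (q :* c₁) :* v :+ con 16 :* (q :* M) := con 16 :* q :* (c₁ :* v :+ M)) refl q c₁ v M) ⟩
  16 * q * (c₁ * v + M) + 18 * X * c                      ≤⟨ +-monoˡ-≤ (18 * X * c) (*-monoʳ-≤ (16 * q) tot) ⟩
  16 * q * (r * N) + 18 * X * c                           ≡⟨ cong (_+ 18 * X * c) (solve 3 (λ q r N → con 16 :* q :* (r :* N) := con 16 :* (q :* r) :* N) refl q r N) ⟩
  16 * (q * r) * N + 18 * X * c                           ∎
  where
  open ≤-Reasoning
  open +-*-Solver
  X = q * c₁
  M = r * o
  16X+2≤18X : 16 * X + 2 ≤ 18 * X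
  16X+2≤18X = ≤-trans (+-monoʳ-≤ (16 * X) (*-monoʳ-≤ 2 {1} {X} (*-mono-≤ {1} {q} {1} {c₁} 1≤q 1≤c₁)))
    (≤-reflexive (solve 1 (λ X → con 16 :* X :+ con 2 :* X := con 18 :* X) refl X))
  light-bound : 2 * c₁ * l ≤ 2 * c₁ * c + M
  light-bound = begin
    2 * c₁ * l                   ≤⟨ *-monoʳ-≤ (2 * c₁) l≤ ⟩
    2 * c₁ * (z + w)             ≡⟨ *-distribˡ-+ (2 * c₁) z w ⟩
    2 * c₁ * z + 2 * c₁ * w      ≤⟨ +-mono-≤ (*-monoʳ-≤ (2 * c₁) z≤) (*-monoˡ-≤ w 2c₁≤ra) ⟩
    2 * c₁ * c + r * a * w       ≡⟨ cong (2 * c₁ * c +_) (*-assoc r a w) ⟩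
    2 * c₁ * c + r * (a * w)     ≤⟨ +-monoʳ-≤ (2 * c₁ * c) (*-monoʳ-≤ r w≤) ⟩
    2 * c₁ * c + M               ∎

-- The lower bound: counting r-cliques inside and outside the q-cliques

module Counting (r′ p : ℕ) (2≤r′ : 2 ≤ r′) (r≤p : suc r′ ≤ p) where
  open Blocks r′ p public

  -- `a` counts the private r-cliques of a remote light vertex, and `R` is the threshold between
  -- light and heavy. `c` bounds the zone: at most q vertices in K, each in at most `R` outer
  -- r-cliques of r vertices.
  c₁ a R c : ℕ
  c₁ = (p + r′) C r′
  a  = p C r′
  R  = 6 * c₁
  c  = q + r * (R * q)

  module _ {n : ℕ} (G : SimpleGraph n) (free : FreeOf (Adj G))
    (sat : ∀ u v → u ≢ v → ¬ Adj G u v → ∃ λ i → CopyIn (chain (sizes i)) (AddEdge G u v)) where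

    open Saturation 2≤r′ r≤p G free sat

    V : List (Fin n)
    V = allFin n

    𝒮 : List (Subset n)
    𝒮 = allSubsets n

    RClique InClique : Subset n → Set
    RClique S = ∣ S ∣ ≡ r × IsClique G S
    InClique S = RClique S × ∃ λ Q → QClique G Q × S ⊆ Q

    rClique? : ∀ S → Dec (RClique S)
    rClique? S = (∣ S ∣ ≟ r) ×-dec isClique? G S

    contained? : ∀ S → Dec (∃ λ Q → QClique G Q × S ⊆ Q)
    contained? S = anySubset? (λ Q → qClique? G Q ×-dec (S ⊆? Q))

    inClique? : ∀ S → Dec (InClique S)
    inClique? S = rClique? S ×-dec contained? S

    outClique? : ∀ S → Dec (OutClique S)
    outClique? S = rClique? S ×-dec
      map′ (λ k Q qc i → k (Q , qc , λ {x} → i {x})) (λ k (Q , qc , i) → k Q qc (λ {x} → i {x})) (¬? (contained? S))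

    N outs : ℕ
    N    = copiesK G r
    outs = ∑ 𝒮 (λ S → ⟦ outClique? S ⟧)

    outDegree : Fin n → ℕ
    outDegree x = ∑ 𝒮 (λ S → ⟦ x ∈? S ⟧ * ⟦ outClique? S ⟧)

    ∑-outDegree : ∑ V outDegree ≡ r * outs
    ∑-outDegree = ∑-incidences outClique? r (λ S → proj₁ ∘ proj₁)

    in+out : ∀ S → ⟦ inClique? S ⟧ + ⟦ outClique? S ⟧ ≤ ⟦ rClique? S ⟧
    in+out S with contained? S
    ... | yes k rewrite ⟦⟧-no (rClique? S ×-dec map′ {B = ∀ Q → QClique G Q → ¬ (S ⊆ Q)}
                                (λ k Q qc i → k (Q , qc , λ {x} → i {x})) (λ k (Q , qc , i) → k Q qc (λ {x} → i {x})) (¬? (yes k)))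
                              (λ (_ , k′) → k′ (proj₁ k) (proj₁ (proj₂ k)) (proj₂ (proj₂ k)))
      = ≤-trans (≤-reflexive (+-identityʳ _)) (⟦⟧-mono (rClique? S ×-dec yes k) (rClique? S) proj₁)
    ... | no k rewrite ⟦⟧-no (rClique? S ×-dec no k) (λ (_ , y) → k y)
      = ⟦⟧-mono (rClique? S ×-dec _) (rClique? S) proj₁

    covered : ℕ
    covered = ∑ V (λ x → ⟦ covered? G x ⟧)

    -- All r-subsets through x of a q-clique at x count, and there are c₁ of them.
    ∑-inDegree : c₁ * covered ≤ r * ∑ 𝒮 (λ S → ⟦ inClique? S ⟧)
    ∑-inDegree = begin
      c₁ * covered                                              ≡⟨ ∑-* V c₁ _ ⟨
      ∑ V (λ x → c₁ * ⟦ covered? G x ⟧)                          ≤⟨ ∑-mono V (λ x → degree x (covered? G x)) ⟩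
      ∑ V (λ x → ∑ 𝒮 (λ S → ⟦ x ∈? S ⟧ * ⟦ inClique? S ⟧))       ≡⟨ ∑-incidences inClique? r (λ S → proj₁ ∘ proj₁) ⟩
      r * ∑ 𝒮 (λ S → ⟦ inClique? S ⟧)                           ∎
      where
      open ≤-Reasoning
      degree : ∀ x (d : Dec (Covered G x)) → c₁ * ⟦ d ⟧ ≤ ∑ 𝒮 (λ S → ⟦ x ∈? S ⟧ * ⟦ inClique? S ⟧)
      degree x (no _) = ≤-trans (≤-reflexive (*-zeroʳ c₁)) z≤n
      degree x (yes (Q , (e , cl) , x∈Q)) = begin
        c₁ * 1                                       ≡⟨ *-identityʳ c₁ ⟩
        c₁                                           ≡⟨ countPointed x Q (p + r′) r′ x∈Q e ⟨
        ∑ 𝒮 (λ S → ⟦ pointedIn? x Q r S ⟧)           ≤⟨ ∑-mono 𝒮 (λ S → ≤-trans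
           (⟦⟧-mono (pointedIn? x Q r S) ((x ∈? S) ×-dec inClique? S)
             (λ (x∈ , i , e′) → x∈ , (e′ , clique-⊆ {E = Adj G} {S} {Q} i cl) , Q , (e , cl) , λ {y} → i {y}))
           (≤-reflexive (⟦⟧-× (x ∈? S) (inClique? S)))) ⟩
        ∑ 𝒮 (λ S → ⟦ x ∈? S ⟧ * ⟦ inClique? S ⟧)    ∎

    total : c₁ * covered + r * outs ≤ r * N
    total = begin
      c₁ * covered + r * outs                                            ≤⟨ +-monoˡ-≤ (r * outs) ∑-inDegree ⟩
      r * ∑ 𝒮 (λ S → ⟦ inClique? S ⟧) + r * outs                         ≡⟨ *-distribˡ-+ r (∑ 𝒮 (λ S → ⟦ inClique? S ⟧)) outs ⟨
      r * (∑ 𝒮 (λ S → ⟦ inClique? S ⟧) + outs)                           ≡⟨ cong (r *_) (∑-+ 𝒮 _ _) ⟨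
      r * ∑ 𝒮 (λ S → ⟦ inClique? S ⟧ + ⟦ outClique? S ⟧)                 ≤⟨ *-monoʳ-≤ r (∑-mono 𝒮 in+out) ⟩
      r * ∑ 𝒮 (λ S → ⟦ rClique? S ⟧)                                     ≡⟨ cong (r *_) (copiesK-∑ G r) ⟨
      r * N                                                              ∎
      where open ≤-Reasoning

    outDegree-positive : ∀ {S x} → OutClique S → x ∈ S → 1 ≤ outDegree x
    outDegree-positive {S} {x} o x∈ = ≤-trans
      (≤-reflexive (sym (cong₂ _*_ (⟦⟧-yes (x ∈? S) x∈) (⟦⟧-yes (outClique? S) o))))
      (∑-term (λ S → ⟦ x ∈? S ⟧ * ⟦ outClique? S ⟧) (∈-allSubsets S))

    -- The q-cliques partition the covered vertices, and each of them meets an r-clique counted by outs.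
    covered-bound : ∀ {u} → ¬ Covered G u → covered ≤ q * (r * outs)
    covered-bound {u} ¬cu = begin
      covered                                             ≤⟨ ∑-mono V (λ x → charge x (covered? G x)) ⟩
      ∑ V (λ x → ∑ V (λ y → ⟦ mate? x y ⟧ * outDegree y))   ≡⟨ ∑-swap V V _ ⟩
      ∑ V (λ y → ∑ V (λ x → ⟦ mate? x y ⟧ * outDegree y))   ≤⟨ ∑-mono V mates ⟩
      ∑ V (λ y → q * outDegree y)                         ≡⟨ ∑-* V q outDegree ⟩
      q * ∑ V outDegree                                   ≡⟨ cong (q *_) ∑-outDegree ⟩
      q * (r * outs)                                      ∎
      where
      open ≤-Reasoning
      Mate : Fin n → Fin n → Set
      Mate x y = ∃ λ Q → QClique G Q × x ∈ Q × y ∈ Q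
      mate? : ∀ x y → Dec (Mate x y)
      mate? x y = anySubset? (λ Q → qClique? G Q ×-dec ((x ∈? Q) ×-dec (y ∈? Q)))
      charge : ∀ x (d : Dec (Covered G x)) → ⟦ d ⟧ ≤ ∑ V (λ y → ⟦ mate? x y ⟧ * outDegree y)
      charge x (no _) = z≤n
      charge x (yes (Q , qc , x∈)) =
        let S , o , y , y∈S , y∈Q = attached ¬cu qc in
        ≤-trans (*-mono-≤ (≤-reflexive (sym (⟦⟧-yes (mate? x y) (Q , qc , x∈ , y∈Q)))) (outDegree-positive o y∈S))
          (∑-term (λ y → ⟦ mate? x y ⟧ * outDegree y) (∈-allFin y))
      few : ∀ y → ∑ V (λ x → ⟦ mate? x y ⟧) ≤ q
      few y with covered? G y
      ... | yes (Q , qc , y∈) = ≤-trans (∑-≤∣∣ (λ x → mate? x y) Q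
              (λ x (Q′ , qc′ , x∈′ , y∈′) → qclique-unique G free qc qc′ y∈ y∈′ x∈′)) (≤-reflexive (proj₁ qc))
      ... | no ¬c = ≤-trans (≤-reflexive (∑-zero V (λ x → ⟦⟧-no (mate? x y) (λ (Q , qc , _ , y∈) → ¬c (Q , qc , y∈))))) z≤n
      mates : ∀ y → ∑ V (λ x → ⟦ mate? x y ⟧ * outDegree y) ≤ q * outDegree y
      mates y = begin
        ∑ V (λ x → ⟦ mate? x y ⟧ * outDegree y) ≡⟨ ∑-cong V (λ x → *-comm ⟦ mate? x y ⟧ _) ⟩
        ∑ V (λ x → outDegree y * ⟦ mate? x y ⟧) ≡⟨ ∑-* V (outDegree y) _ ⟩
        outDegree y * ∑ V (λ x → ⟦ mate? x y ⟧) ≤⟨ *-monoʳ-≤ (outDegree y) (few y) ⟩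
        outDegree y * q                        ≡⟨ *-comm (outDegree y) q ⟩
        q * outDegree y                        ∎

    Heavy Light : Fin n → Set
    Heavy x = ¬ Covered G x × R ≤ outDegree x
    Light x = ¬ Covered G x × ¬ (R ≤ outDegree x)

    heavy? : ∀ x → Dec (Heavy x)
    heavy? x = ¬? (covered? G x) ×-dec (R ≤? outDegree x)

    light? : ∀ x → Dec (Light x)
    light? x = ¬? (covered? G x) ×-dec ¬? (R ≤? outDegree x)

    heavy light : ℕ
    heavy = ∑ V (λ x → ⟦ heavy? x ⟧)
    light = ∑ V (λ x → ⟦ light? x ⟧)

    heavy-bound : R * heavy ≤ r * outs
    heavy-bound = begin
      R * heavy                   ≡⟨ ∑-* V R _ ⟨
      ∑ V (λ x → R * ⟦ heavy? x ⟧) ≤⟨ ∑-mono V (λ x → bound x (heavy? x)) ⟩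
      ∑ V outDegree               ≡⟨ ∑-outDegree ⟩
      r * outs                    ∎
      where
      open ≤-Reasoning
      bound : ∀ x (d : Dec (Heavy x)) → R * ⟦ d ⟧ ≤ outDegree x
      bound x (yes (_ , h)) = ≤-trans (≤-reflexive (*-identityʳ R)) h
      bound x (no _)        = ≤-trans (≤-reflexive (*-zeroʳ R)) z≤n

    partition : n ≤ covered + (heavy + light)
    partition = begin
      n                                                                  ≡⟨ ∑-one n ⟨
      ∑ V (λ _ → 1)                                                      ≤⟨ ∑-mono V cases ⟩
      ∑ V (λ x → ⟦ covered? G x ⟧ + (⟦ heavy? x ⟧ + ⟦ light? x ⟧))        ≡⟨ ∑-+ V _ _ ⟩
      covered + ∑ V (λ x → ⟦ heavy? x ⟧ + ⟦ light? x ⟧)                  ≡⟨ cong (covered +_) (∑-+ V _ _) ⟩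
      covered + (heavy + light)                                          ∎
      where
      open ≤-Reasoning
      cases : ∀ x → 1 ≤ ⟦ covered? G x ⟧ + (⟦ heavy? x ⟧ + ⟦ light? x ⟧)
      cases x with covered? G x | R ≤? outDegree x
      ... | yes _ | _     = s≤s z≤n
      ... | no _  | yes _ = s≤s z≤n
      ... | no _  | no _  = s≤s z≤n

    -- Every light vertex outside a maximal clique K of light vertices shares a p-clique with a member
    -- of K; the r-cliques through K span only boundedly many vertices (the zone), so these p-cliques
    -- all lie in a bounded set.
    module Zones (K : Subset n) (K-clique : IsClique G K) (K-light : ∀ {x} → x ∈ K → Light x)
      (K-max : ∀ u → Light u → u ∉ K → ∃ λ w → w ∈ K × ¬ Adj G u w) where

      ∣K∣≤q : ∣ K ∣ ≤ q
      ∣K∣≤q with q ≤? ∣ K ∣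
      ... | no q≰ = <⇒≤ (≰⇒> q≰)
      ... | yes q≤ = let x , x∈ = ∣p∣>0⇒Nonempty K (≤-trans (s≤s z≤n) q≤) in
                     ⊥-elim (proj₁ (K-light x∈) (covers G K-clique q≤ x∈))

      Linked Zone : Fin n → Set
      Linked y = ∃ λ w → w ∈ K × ∃ λ S → OutClique S × w ∈ S × y ∈ S
      Zone y = y ∈ K ⊎ Linked y

      linked? : ∀ y → Dec (Linked y)
      linked? y = any? (λ w → (w ∈? K) ×-dec anySubset? (λ S → outClique? S ×-dec ((w ∈? S) ×-dec (y ∈? S))))

      zone? : ∀ y → Dec (Zone y)
      zone? y = (y ∈? K) ⊎-dec linked? y

      -- Each linked vertex is charged to a member w of K and an outer r-clique through w. Lightness
      -- limits these r-cliques to fewer than `R` per w, and each has r vertices.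
      ∑-linked : ∑ V (λ y → ⟦ linked? y ⟧) ≤ r * (R * ∣ K ∣)
      ∑-linked = begin
        ∑ V (λ y → ⟦ linked? y ⟧)                                                       ≤⟨ ∑-mono V (λ y → charge y (linked? y)) ⟩
        ∑ V (λ y → ∑ V (λ w → ∑ 𝒮 (λ S → ⟦ y ∈? S ⟧ * weight w S)))                      ≡⟨ ∑-swap V V _ ⟩
        ∑ V (λ w → ∑ V (λ y → ∑ 𝒮 (λ S → ⟦ y ∈? S ⟧ * weight w S)))                      ≡⟨ ∑-cong V (λ w → ∑-incidences (through? w) r (λ S → proj₁ ∘ proj₁ ∘ proj₂ ∘ proj₂)) ⟩
        ∑ V (λ w → r * ∑ 𝒮 (weight w))                                                   ≡⟨ ∑-* V r _ ⟩
        r * ∑ V (λ w → ∑ 𝒮 (weight w))                                                   ≤⟨ *-monoʳ-≤ r (∑-mono V (λ w → degree w (w ∈? K))) ⟩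
        r * ∑ V (λ w → R * ⟦ w ∈? K ⟧)                                                   ≡⟨ cong (r *_) (∑-* V R _) ⟩
        r * (R * ∑ V (λ w → ⟦ w ∈? K ⟧))                                                 ≡⟨ cong (λ m → r * (R * m)) (∑-∈ K) ⟩
        r * (R * ∣ K ∣)                                                                 ∎
        where
        open ≤-Reasoning
        Through : Fin n → Subset n → Set
        Through w S = w ∈ K × w ∈ S × OutClique S
        through? : ∀ w S → Dec (Through w S)
        through? w S = (w ∈? K) ×-dec ((w ∈? S) ×-dec outClique? S)
        weight : Fin n → Subset n → ℕ
        weight w S = ⟦ through? w S ⟧
        charge : ∀ y (d : Dec (Linked y)) → ⟦ d ⟧ ≤ ∑ V (λ w → ∑ 𝒮 (λ S → ⟦ y ∈? S ⟧ * weight w S))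
        charge y (no _) = z≤n
        charge y (yes (w , w∈K , S , o , w∈S , y∈S)) = begin
          1                                             ≡⟨ cong₂ _*_ (⟦⟧-yes (y ∈? S) y∈S) (⟦⟧-yes (through? w S) (w∈K , w∈S , o)) ⟨
          ⟦ y ∈? S ⟧ * weight w S                        ≤⟨ ∑-term (λ S → ⟦ y ∈? S ⟧ * weight w S) (∈-allSubsets S) ⟩
          ∑ 𝒮 (λ S → ⟦ y ∈? S ⟧ * weight w S)            ≤⟨ ∑-term (λ w → ∑ 𝒮 (λ S → ⟦ y ∈? S ⟧ * weight w S)) (∈-allFin w) ⟩
          ∑ V (λ w → ∑ 𝒮 (λ S → ⟦ y ∈? S ⟧ * weight w S)) ∎
        degree : ∀ w (d : Dec (w ∈ K)) → ∑ 𝒮 (λ S → ⟦ through? w S ⟧) ≤ R * ⟦ d ⟧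
        degree w (yes w∈) = begin
          ∑ 𝒮 (λ S → ⟦ through? w S ⟧)                   ≤⟨ ∑-mono 𝒮 (λ S → ≤-trans (⟦⟧-mono (through? w S) ((w ∈? S) ×-dec outClique? S) proj₂)
                                                               (≤-reflexive (⟦⟧-× (w ∈? S) (outClique? S)))) ⟩
          outDegree w                                    ≤⟨ <⇒≤ (≰⇒> (proj₂ (K-light w∈))) ⟩
          R                                              ≡⟨ *-identityʳ R ⟨
          R * 1                                          ∎
        degree w (no w∉) = ≤-trans (≤-reflexive (∑-zero 𝒮 (λ S → ⟦⟧-no (through? w S) (w∉ ∘ proj₁)))) z≤n

      zone : ℕ
      zone = ∑ V (λ y → ⟦ zone? y ⟧)

      zone≤c : zone ≤ c
      zone≤c = begin
        zone                                                     ≤⟨ ∑-mono V (λ y → either (y ∈? K) (linked? y)) ⟩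
        ∑ V (λ y → ⟦ y ∈? K ⟧ + ⟦ linked? y ⟧)                    ≡⟨ ∑-+ V _ _ ⟩
        ∑ V (λ y → ⟦ y ∈? K ⟧) + ∑ V (λ y → ⟦ linked? y ⟧)        ≤⟨ +-mono-≤ (≤-trans (≤-reflexive (∑-∈ K)) ∣K∣≤q)
                                                                      (≤-trans ∑-linked (*-monoʳ-≤ r (*-monoʳ-≤ R ∣K∣≤q))) ⟩
        c                                                        ∎
        where
        open ≤-Reasoning
        either : ∀ {A B : Set} (d : Dec A) (e : Dec B) → ⟦ d ⊎-dec e ⟧ ≤ ⟦ d ⟧ + ⟦ e ⟧
        either (yes _) e = s≤s z≤n
        either (no _)  (yes _) = ≤-refl
        either (no _)  (no _)  = z≤n

      Remote : Fin n → Set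
      Remote u = Light u × ¬ Zone u

      remote? : ∀ u → Dec (Remote u)
      remote? u = light? u ×-dec ¬? (zone? u)

      remote : ℕ
      remote = ∑ V (λ u → ⟦ remote? u ⟧)

      light≤ : light ≤ zone + remote
      light≤ = ≤-trans (∑-mono V (λ u → cases (light? u) (zone? u))) (≤-reflexive (∑-+ V _ _))
        where
        cases : ∀ {A B : Set} (d : Dec A) (e : Dec B) → ⟦ d ⟧ ≤ ⟦ e ⟧ + ⟦ d ×-dec ¬? e ⟧
        cases (no _)  e       = z≤n
        cases (yes _) (yes _) = s≤s z≤n
        cases (yes _) (no _)  = s≤s z≤n

      -- S is private to u: u is its only vertex outside the zone. Hence no r-clique is charged by
      -- two remote vertices.
      Tip : Fin n → Subset n → Set
      Tip u S = u ∈ S × ¬ Zone u × (∀ z → z ∈ S → z ≡ u ⊎ Zone z)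

      tip? : ∀ u S → Dec (Tip u S)
      tip? u S = (u ∈? S) ×-dec (¬? (zone? u) ×-dec all? (λ z → (z ∈? S) →-dec ((z ≟ᶠ u) ⊎-dec zone? z)))

      -- Maximality of K gives a non-neighbour w of u in K, and u and w share a p-clique P. Since P
      -- lies in the zone, the C(p, r-1) r-subsets of P with u that contain u all have u as their
      -- tip.
      remote-degree : ∀ {u} → Remote u → a ≤ ∑ 𝒮 (λ S → ⟦ tip? u S ⟧ * ⟦ outClique? S ⟧)
      remote-degree {u} (light-u , ¬zu) =
        let w , w∈K , na = K-max u light-u (¬zu ∘ inj₁)
            P , e , u∉P , cu , cw = commonClique {u} {w} (λ e → ¬zu (inj₁ (subst (_∈ K) (sym e) w∈K))) na (proj₁ light-u) (proj₁ (K-light w∈K))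
        in fan w w∈K P e u∉P cu cw
        where
        fan : ∀ w → w ∈ K → ∀ P → ∣ P ∣ ≡ p → u ∉ P → IsClique G (P ∪ ⁅ u ⁆) → IsClique G (P ∪ ⁅ w ⁆) →
              a ≤ ∑ 𝒮 (λ S → ⟦ tip? u S ⟧ * ⟦ outClique? S ⟧)
        fan w w∈K P ∣P∣ u∉P cu cw = begin
          a                                                ≡⟨ countPointed u (P ∪ ⁅ u ⁆) p r′ (q⊆p∪q P _ (x∈⁅x⁆ u)) size-P⁺ ⟨
          ∑ 𝒮 (λ S → ⟦ pointedIn? u (P ∪ ⁅ u ⁆) r S ⟧)      ≤⟨ ∑-mono 𝒮 (λ S → ≤-trans
                (⟦⟧-mono (pointedIn? u (P ∪ ⁅ u ⁆) r S) (tip? u S ×-dec outClique? S) (good S))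
                (≤-reflexive (⟦⟧-× (tip? u S) (outClique? S)))) ⟩
          ∑ 𝒮 (λ S → ⟦ tip? u S ⟧ * ⟦ outClique? S ⟧)       ∎
          where
          open ≤-Reasoning
          1+p : ∀ m → m ≡ p → m + ∣ ⁅ u ⁆ ∣ ≡ suc p
          1+p m refl = trans (cong (p +_) (∣⁅x⁆∣≡1 u)) (+-comm p 1)
          size-P⁺ : ∣ P ∪ ⁅ u ⁆ ∣ ≡ suc p
          size-P⁺ = ≤-antisym (≤-trans (∣p∪q∣≤∣p∣+∣q∣ P ⁅ u ⁆) (≤-reflexive (1+p ∣ P ∣ ∣P∣)))
            (≤-trans (≤-reflexive (sym (1+p ∣ P ∣ ∣P∣))) (disjoint⇒∣p∣+∣q∣≤∣p∪q∣ P ⁅ u ⁆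
              (λ x∈ x∈u → u∉P (subst (_∈ P) (x∈⁅y⁆⇒x≡y u x∈u) x∈))))
          -- As w is uncovered, an r-clique through w and y lies in no q-clique, so it links y to K.
          P⊆zone : ∀ {y} → y ∈ P → Zone y
          P⊆zone {y} y∈ =
            let S , rc , w∈S , y∈S , _ = rClique {P ∪ ⁅ w ⁆} {w} {y} cw
                  (≤-trans r≤p (≤-trans (≤-reflexive (sym ∣P∣)) (∣p∣≤∣p∪q∣ P ⁅ w ⁆))) (q⊆p∪q P _ (x∈⁅x⁆ w)) (p⊆p∪q _ y∈)
            in inj₂ (w , w∈K , S , uncovered⇒out (proj₁ (K-light w∈K)) rc w∈S , w∈S , y∈S)
          good : ∀ S → PointedIn u (P ∪ ⁅ u ⁆) r S → Tip u S × OutClique S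
          good S (u∈ , i , e) =
            (u∈ , ¬zu , λ z z∈ → [ inj₂ ∘ P⊆zone , inj₁ ∘ x∈⁅y⁆⇒x≡y u ]′ (x∈p∪q⁻ P ⁅ u ⁆ (i z∈))) ,
            uncovered⇒out (proj₁ light-u) (e , clique-⊆ {E = Adj G} {S} {P ∪ ⁅ u ⁆} i cu) u∈

      one-tip : ∀ S → ∑ V (λ u → ⟦ tip? u S ⟧) ≤ 1
      one-tip S with any? (λ u → tip? u S)
      ... | no none = ≤-trans (≤-reflexive (∑-zero V (λ u → ⟦⟧-no (tip? u S) (λ t → none (u , t))))) z≤n
      ... | yes (u , _ , _ , rest) = ≤-trans
        (∑-≤∣∣ (λ v → tip? v S) ⁅ u ⁆ (λ v (v∈ , ¬zv , _) → [ (λ e → subst (_∈ ⁅ u ⁆) (sym e) (x∈⁅x⁆ u)) , ⊥-elim ∘ ¬zv ]′ (rest v v∈)))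
        (≤-reflexive (∣⁅x⁆∣≡1 u))

      remote-bound : a * remote ≤ outs
      remote-bound = begin
        a * remote                                                     ≡⟨ ∑-* V a _ ⟨
        ∑ V (λ u → a * ⟦ remote? u ⟧)                                   ≤⟨ ∑-mono V (λ u → bound u (remote? u)) ⟩
        ∑ V (λ u → ∑ 𝒮 (λ S → ⟦ tip? u S ⟧ * ⟦ outClique? S ⟧))         ≡⟨ ∑-swap V 𝒮 _ ⟩
        ∑ 𝒮 (λ S → ∑ V (λ u → ⟦ tip? u S ⟧ * ⟦ outClique? S ⟧))         ≤⟨ ∑-mono 𝒮 single ⟩
        outs                                                           ∎
        where
        open ≤-Reasoning
        bound : ∀ u (d : Dec (Remote u)) → a * ⟦ d ⟧ ≤ ∑ 𝒮 (λ S → ⟦ tip? u S ⟧ * ⟦ outClique? S ⟧)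
        bound u (yes h) = ≤-trans (≤-reflexive (*-identityʳ a)) (remote-degree h)
        bound u (no _)  = ≤-trans (≤-reflexive (*-zeroʳ a)) z≤n
        single : ∀ S → ∑ V (λ u → ⟦ tip? u S ⟧ * ⟦ outClique? S ⟧) ≤ ⟦ outClique? S ⟧
        single S = begin
          ∑ V (λ u → ⟦ tip? u S ⟧ * ⟦ outClique? S ⟧) ≡⟨ ∑-cong V (λ u → *-comm ⟦ tip? u S ⟧ _) ⟩
          ∑ V (λ u → ⟦ outClique? S ⟧ * ⟦ tip? u S ⟧) ≡⟨ ∑-* V ⟦ outClique? S ⟧ _ ⟩
          ⟦ outClique? S ⟧ * ∑ V (λ u → ⟦ tip? u S ⟧) ≤⟨ *-monoʳ-≤ ⟦ outClique? S ⟧ (one-tip S) ⟩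
          ⟦ outClique? S ⟧ * 1                        ≡⟨ *-identityʳ _ ⟩
          ⟦ outClique? S ⟧                            ∎

    -- Every vertex then lies in exactly one q-clique, so counting incidences gives n as q times the
    -- number of q-cliques.
    all-covered⇒q∣n : (∀ x → Covered G x) → q ∣ n
    all-covered⇒q∣n cov = divides (∑ 𝒮 (λ Q → ⟦ qClique? G Q ⟧)) (begin
      n                                                    ≡⟨ ∑-one n ⟨
      ∑ V (λ _ → 1)                                        ≡⟨ ∑-cong V (λ x → once x (cov x)) ⟨
      ∑ V (λ x → ∑ 𝒮 (λ Q → ⟦ x ∈? Q ⟧ * ⟦ qClique? G Q ⟧)) ≡⟨ ∑-incidences (qClique? G) q (λ Q → proj₁) ⟩
      q * ∑ 𝒮 (λ Q → ⟦ qClique? G Q ⟧)                      ≡⟨ *-comm q _ ⟩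
      ∑ 𝒮 (λ Q → ⟦ qClique? G Q ⟧) * q                      ∎)
      where
      open ≡-Reasoning
      once : ∀ x → Covered G x → ∑ 𝒮 (λ Q → ⟦ x ∈? Q ⟧ * ⟦ qClique? G Q ⟧) ≡ 1
      once x (Q , qc , x∈) = ≤-antisym
        (≤-trans (∑-mono 𝒮 (λ S → ≤-trans (≤-reflexive (sym (⟦⟧-× (x ∈? S) (qClique? G S))))
           (⟦⟧-mono ((x ∈? S) ×-dec qClique? G S) (pointedIn? x Q q S)
             (λ (x∈S , qcS) → x∈S , (λ {y} → qclique-unique G free qc qcS x∈ x∈S {y}) , proj₁ qcS))))
          (≤-reflexive (trans (countPointed x Q (p + r′) (p + r′) x∈ (proj₁ qc)) (nCn≡1 (p + r′)))))
        (≤-trans (≤-reflexive (sym (cong₂ _*_ (⟦⟧-yes (x ∈? Q) x∈) (⟦⟧-yes (qClique? G Q) qc))))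
          (∑-term (λ Q → ⟦ x ∈? Q ⟧ * ⟦ qClique? G Q ⟧) (∈-allSubsets Q)))

    -- Otherwise q divides both kq + 1 and kq, hence 1, against q ≥ p + 2.
    uncovered-exists : ∀ k → n ≡ k * q + 1 → ∃ λ u → ¬ Covered G u
    uncovered-exists k e with all? (covered? G)
    ... | no ¬all = ¬∀⟶∃¬ n _ (covered? G) ¬all
    ... | yes all = ⊥-elim (1+n≰n (≤-trans p+2≤q (≤-trans
            (≤-reflexive (∣1⇒≡1 (∣m+n∣m⇒∣n (subst (q ∣_) e (all-covered⇒q∣n all)) (n∣m*n k)))) (s≤s z≤n))))

    light-split : ∃ λ z → ∃ λ w → light ≤ z + w × z ≤ c × a * w ≤ outs
    light-split =
      let K , K-clique , K-light , K-max = maximalClique G light?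
          open Zones K K-clique K-light K-max
      in zone , remote , light≤ , zone≤c , remote-bound

    lower-bound : 2 * c₁ ≤ r * a → 1 ≤ c₁ → ∀ {u} → ¬ Covered G u →
      (16 * (q * c₁) + 2) * n ≤ 16 * (q * r) * N + 18 * (q * c₁) * c
    lower-bound 2c₁≤ra 1≤c₁ ¬cu =
      let z , w , l≤ , z≤ , w≤ = light-split in
      weigh {q} {c₁} {r} {a} {N} {outs} {n} {covered} {heavy} {light} {z} {w} {c} (s≤s z≤n) 1≤c₁ 2c₁≤ra
        partition total (covered-bound ¬cu) heavy-bound l≤ z≤ w≤

-- Binomial coefficients

absorption : ∀ n k → suc k * (suc n C suc k) ≡ suc n * (n C k)
absorption zero    zero    = refl
absorption zero    (suc k) = trans (cong (suc (suc k) *_) (k>n⇒nCk≡0 {1} {suc (suc k)} (s≤s (s≤s z≤n))))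
  (trans (*-zeroʳ (suc (suc k))) (sym (trans (+-identityʳ _) (k>n⇒nCk≡0 {0} {suc k} (s≤s z≤n)))))
absorption (suc n) zero    = trans (+-identityʳ _) (trans (nC1≡n (suc (suc n)))
  (sym (trans (cong (suc (suc n) *_) (nC0≡1 (suc n))) (*-identityʳ (suc (suc n))))))
absorption (suc n) (suc k) = begin
  suc (suc k) * (suc (suc n) C suc (suc k))                   ≡⟨ cong (suc (suc k) *_) (nCk+nC[k+1]≡[n+1]C[k+1] (suc n) (suc k)) ⟨
  suc (suc k) * (x + (suc n C suc (suc k)))                   ≡⟨ *-distribˡ-+ (suc (suc k)) x _ ⟩
  suc (suc k) * x + suc (suc k) * (suc n C suc (suc k))       ≡⟨ cong (suc (suc k) * x +_) (absorption n (suc k)) ⟩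
  x + suc k * x + suc n * (n C suc k)                         ≡⟨ cong (λ y → x + y + suc n * (n C suc k)) (absorption n k) ⟩
  x + suc n * (n C k) + suc n * (n C suc k)                   ≡⟨ +-assoc x _ _ ⟩
  x + (suc n * (n C k) + suc n * (n C suc k))                 ≡⟨ cong (x +_) (*-distribˡ-+ (suc n) (n C k) _) ⟨
  x + suc n * (n C k + n C suc k)                             ≡⟨ cong (λ y → x + suc n * y) (nCk+nC[k+1]≡[n+1]C[k+1] n k) ⟩
  suc (suc n) * x                                             ∎
  where
  open ≡-Reasoning
  x = suc n C suc k

-- Adding `suc k * (n C k)` to both sides turns the left one, by Pascal's rule, into the left side
-- of `absorption`.
C-ratio : ∀ p k → suc k * ((p + suc k) C suc k) ≡ suc p * ((p + suc k) C k)
C-ratio p k = +-cancelˡ-≡ (suc k * (n C k)) _ _ (begin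
  suc k * (n C k) + suc k * (n C suc k)   ≡⟨ *-distribˡ-+ (suc k) (n C k) _ ⟨
  suc k * (n C k + n C suc k)             ≡⟨ cong (suc k *_) (nCk+nC[k+1]≡[n+1]C[k+1] n k) ⟩
  suc k * (suc n C suc k)                 ≡⟨ absorption n k ⟩
  suc n * (n C k)                         ≡⟨ cong (_* (n C k)) (+-comm (suc p) (suc k)) ⟩
  (suc k + suc p) * (n C k)               ≡⟨ *-distribʳ-+ (n C k) (suc k) (suc p) ⟩
  suc k * (n C k) + suc p * (n C k)       ∎)
  where
  open ≡-Reasoning
  n = p + suc k

C-mono : ∀ n k → n C k ≤ suc n C k
C-mono n zero    = ≤-reflexive (trans (nC0≡1 n) (sym (nC0≡1 (suc n))))
C-mono n (suc k) = ≤-trans (m≤n+m _ (n C k)) (≤-reflexive (nCk+nC[k+1]≡[n+1]C[k+1] n k))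

C-positive : ∀ p k → 1 ≤ (p + k) C k
C-positive zero    k = ≤-reflexive (sym (nCn≡1 k))
C-positive (suc p) k = ≤-trans (C-positive p k) (C-mono (p + k) k)

-- Raising the upper index from p to p + j takes j Pascal steps, each adding at most the final C(p +
-- j, k).
C-growth : ∀ p j k → (p + j) C suc k ≤ p C suc k + j * ((p + j) C k)
C-growth p zero    k = ≤-reflexive (trans (cong (_C suc k) (+-identityʳ p)) (sym (+-identityʳ _)))
C-growth p (suc j) k rewrite +-suc p j = begin
  suc (p + j) C suc k                                ≡⟨ nCk+nC[k+1]≡[n+1]C[k+1] (p + j) k ⟨
  x + ((p + j) C suc k)                              ≤⟨ +-monoʳ-≤ x (C-growth p j k) ⟩
  x + (p C suc k + j * x)                            ≡⟨ solve 3 (λ x y z → x :+ (y :+ z) := y :+ (x :+ z)) refl x (p C suc k) (j * x) ⟩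
  p C suc k + suc j * x                              ≤⟨ +-monoʳ-≤ (p C suc k) (*-monoʳ-≤ (suc j) (C-mono (p + j) k)) ⟩
  p C suc k + suc j * (suc (p + j) C k)              ∎
  where
  open ≤-Reasoning
  open +-*-Solver
  x = (p + j) C k

-- With r - 1 = k + 1, growth gives y ≤ x + (r - 1) z and the ratio gives (r - 1) y = (p + 1) z. The
-- size of p makes 3 (r - 1) z ≤ y, so 3 y ≤ 3 x + y, that is 2 y ≤ 3 x ≤ r x.
C-shift : ∀ p k → 2 ≤ suc k → 3 * (suc k * suc k) ≤ suc p → 2 * ((p + suc k) C suc k) ≤ suc (suc k) * (p C suc k)
C-shift p k 2≤ big = ≤-trans (+-cancelʳ-≤ y _ _ (begin
  2 * y + y                                  ≡⟨ +-comm (2 * y) y ⟩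
  3 * y                                      ≤⟨ *-monoʳ-≤ 3 (C-growth p (suc k) k) ⟩
  3 * (x + suc k * z)                        ≡⟨ *-distribˡ-+ 3 x (suc k * z) ⟩
  3 * x + 3 * (suc k * z)                    ≤⟨ +-monoʳ-≤ (3 * x) small ⟩
  3 * x + y                                  ∎))
  (*-monoˡ-≤ x (s≤s 2≤))
  where
  open ≤-Reasoning
  open +-*-Solver
  x = p C suc k
  y = (p + suc k) C suc k
  z = (p + suc k) C k
  small : 3 * (suc k * z) ≤ y
  small = *-cancelˡ-≤ (suc k) (begin
    suc k * (3 * (suc k * z))   ≡⟨ solve 2 (λ s z → s :* (con 3 :* (s :* z)) := con 3 :* (s :* s) :* z) refl (suc k) z ⟩
    3 * (suc k * suc k) * z     ≤⟨ *-monoˡ-≤ z big ⟩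
    suc p * z                   ≡⟨ C-ratio p k ⟨
    suc k * y                   ∎)

-- The criterion for divergence

x≤∣x∣ : ∀ x → x ℚ.≤ ℚ.∣ x ∣
x≤∣x∣ x with ℚ.≤-total 0ℚ x
... | inj₁ 0≤x = ℚ.≤-reflexive (sym (ℚ.0≤p⇒∣p∣≡p 0≤x))
... | inj₂ x≤0 = ℚ.≤-trans x≤0 (ℚ.0≤∣p∣ x)

-- Passing to unnormalised rationals restores the given numerators and denominators, which `ℚ./`
-- reduces to lowest terms; cross-multiplication is then plain arithmetic.
close⇒< : ∀ s m t k b → ℚ.∣ (ℤ.+ s) ℚ./ suc m ℚ.- (ℤ.+ t) ℚ./ suc k ∣ ℚ.< (ℤ.+ 1) ℚ./ suc b →
  s * (suc b * suc k) < (suc k + t * suc b) * suc m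
close⇒< s m t k b h = ℤ.drop‿+<+ (subst₂ ℤ._<_ left right (ℚᵘ.drop-*<* unnormalised))
  where
  x = (ℤ.+ s) ℚ./ suc m
  y = (ℤ.+ t) ℚ./ suc k
  ε = (ℤ.+ 1) ℚ./ suc b
  x<ε+y : x ℚ.< ε ℚ.+ y
  x<ε+y = subst (ℚ._< ε ℚ.+ y) cancel (ℚ.+-monoˡ-< y (ℚ.≤-<-trans (x≤∣x∣ (x ℚ.- y)) h))
    where
    cancel : x ℚ.- y ℚ.+ y ≡ x
    cancel = trans (ℚ.+-assoc x (ℚ.- y) y) (trans (cong (x ℚ.+_) (ℚ.+-inverseˡ y)) (ℚ.+-identityʳ x))
  unnormalised : mkℚᵘ (ℤ.+ s) m ℚᵘ.< mkℚᵘ (ℤ.+ 1) b ℚᵘ.+ mkℚᵘ (ℤ.+ t) k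
  unnormalised = ℚᵘ.<-respˡ-≃ (ℚ.toℚᵘ-fromℚᵘ (mkℚᵘ (ℤ.+ s) m))
    (ℚᵘ.<-respʳ-≃ (ℚᵘ.≃-trans (ℚ.toℚᵘ-homo-+ ε y) (ℚᵘ.+-cong (ℚ.toℚᵘ-fromℚᵘ (mkℚᵘ (ℤ.+ 1) b)) (ℚ.toℚᵘ-fromℚᵘ (mkℚᵘ (ℤ.+ t) k))))
      (ℚ.toℚᵘ-mono-< x<ε+y))
  left : ℤ.+ s ℤ.* ℤ.+ (suc b * suc k) ≡ ℤ.+ (s * (suc b * suc k))
  left = sym (ℤ.pos-* s _)
  right : (ℤ.+ 1 ℤ.* ℤ.+ suc k ℤ.+ ℤ.+ t ℤ.* ℤ.+ suc b) ℤ.* ℤ.+ suc m ≡ ℤ.+ ((suc k + t * suc b) * suc m)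
  right = trans (cong (ℤ._* ℤ.+ suc m) (trans (cong₂ ℤ._+_ (ℤ.*-identityˡ (ℤ.+ suc k)) (sym (ℤ.pos-* t (suc b)))) (sym (ℤ.pos-+ (suc k) (t * suc b)))))
    (sym (ℤ.pos-* (suc k + t * suc b) (suc m)))

-- At consecutive lengths n₀ = kq and n₁ = n₀ + 1 the ratios differ by at least 2/B - K/(B n₁). A
-- Cauchy tail for ε = 1/B would therefore force n₁ < K, which fails for large k.
gap⇒¬Cauchy : ∀ (s : ℕ → ℕ) q A B K → 1 ≤ q → 1 ≤ B →
  (∀ k → B * s (k * q) ≤ A * (k * q)) →
  (∀ k → (A + 2) * suc (k * q) ≤ B * s (suc (k * q)) + K) →
  ¬ Cauchy (ratio s)
gap⇒¬Cauchy s (suc q) A (suc b) K _ _ low high cauchy with cauchy ((ℤ.+ 1) ℚ./ suc b) (ℚ.toℚᵘ-cancel-< (ℚᵘ.<-respʳ-≃ (ℚᵘ.≃-sym (ℚ.toℚᵘ-fromℚᵘ (mkℚᵘ (ℤ.+ 1) b))) (ℚᵘ.*<* (ℤ.+<+ (s≤s z≤n)))))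
... | N , tail = <⇒≱ n₁<K (≤-trans (m≤n+m K N) (≤-trans (n≤1+n _) N+K≤n₁))
  where
  -- Large enough both to lie in the Cauchy tail beyond N and to make n₁ exceed K.
  k = suc (N + K)
  n₀ = k * suc q
  n₁ = suc n₀
  s₀ = s n₀
  s₁ = s n₁
  B = suc b
  N+K≤n₁ : suc (N + K) ≤ n₁
  N+K≤n₁ = ≤-trans (m≤m*n k (suc q)) (n≤1+n n₀)
  -- The sequence `ratio` starts at length 1, so length n₀ has index n₀ - 1, written here without
  -- subtraction; q is now the predecessor of the original one.
  N≤m₀ : N ≤ q + (N + K) * suc q
  N≤m₀ = ≤-trans (m≤m+n N K) (≤-trans (m≤m*n (N + K) (suc q)) (m≤n+m _ q))
  near : s₁ * (B * n₀) < (n₀ + s₀ * B) * n₁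
  near = close⇒< s₁ n₀ s₀ (q + (N + K) * suc q) b (tail n₀ (q + (N + K) * suc q) (≤-trans N≤m₀ (n≤1+n _)) N≤m₀)
  n₁<K : n₁ < K
  n₁<K = *-cancelʳ-< n₀ n₁ K (+-cancelˡ-< ((A + 1) * (n₁ * n₀)) _ _ (begin-strict
    (A + 1) * (n₁ * n₀) + n₁ * n₀      ≡⟨ solve 3 (λ A n₁ n₀ → (A :+ con 1) :* (n₁ :* n₀) :+ n₁ :* n₀ := (A :+ con 2) :* n₁ :* n₀) refl A n₁ n₀ ⟩
    (A + 2) * n₁ * n₀                  ≤⟨ *-monoˡ-≤ n₀ (high k) ⟩
    (B * s₁ + K) * n₀                  ≡⟨ solve 4 (λ B s K n → (B :* s :+ K) :* n := s :* (B :* n) :+ K :* n) refl B s₁ K n₀ ⟩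
    s₁ * (B * n₀) + K * n₀             <⟨ +-monoˡ-< (K * n₀) near ⟩
    (n₀ + s₀ * B) * n₁ + K * n₀        ≡⟨ cong (_+ K * n₀) (solve 4 (λ n₀ s₀ B n₁ → (n₀ :+ s₀ :* B) :* n₁ := B :* s₀ :* n₁ :+ n₁ :* n₀) refl n₀ s₀ B n₁) ⟩
    B * s₀ * n₁ + n₁ * n₀ + K * n₀     ≤⟨ +-monoˡ-≤ (K * n₀) (+-monoˡ-≤ (n₁ * n₀) (*-monoˡ-≤ n₁ (low k))) ⟩
    A * n₀ * n₁ + n₁ * n₀ + K * n₀     ≡⟨ cong (_+ K * n₀) (solve 3 (λ A n₁ n₀ → A :* n₀ :* n₁ :+ n₁ :* n₀ := (A :+ con 1) :* (n₁ :* n₀)) refl A n₁ n₀) ⟩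
    (A + 1) * (n₁ * n₀) + K * n₀       ∎))
    where
    open ≤-Reasoning
    open +-*-Solver

-- Assembling the two bounds into divergence

scale : ∀ q r s c m → r * s ≤ c * m → 16 * (q * r) * s ≤ 16 * (q * c) * m
scale q r s c m h = begin
  16 * (q * r) * s   ≡⟨ reorder q r s ⟩
  16 * q * (r * s)   ≤⟨ *-monoʳ-≤ (16 * q) h ⟩
  16 * q * (c * m)   ≡⟨ reorder q c m ⟨
  16 * (q * c) * m   ∎
  where
  open ≤-Reasoning
  open +-*-Solver
  reorder : ∀ x y z → 16 * (x * y) * z ≡ 16 * x * (y * z)
  reorder = solve 3 (λ x y z → con 16 :* (x :* y) :* z := con 16 :* x :* (y :* z)) refl

module Divergence (r′ p : ℕ) (2≤r′ : 2 ≤ r′) (r≤p : suc r′ ≤ p)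
  (shift : 2 * ((p + r′) C r′) ≤ suc r′ * (p C r′)) (F : Family3)
  (unfold : ∀ {n} (E : Fin n → Fin n → Set) → ContainsFam F E → ∃ λ i → CopyIn (chain (Family.sizes r′ p i)) E)
  (fold : ∀ {n} (E : Fin n → Fin n → Set) → (∃ λ i → CopyIn (chain (Family.sizes r′ p i)) E) → ContainsFam F E)
  (s : ℕ → ℕ) (isSat : ∀ n → IsSat F (suc r′) n (s n)) where

  open Counting r′ p 2≤r′ r≤p

  at-multiples : ∀ k → 16 * (q * r) * s (k * q) ≤ 16 * (q * c₁) * (k * q)
  at-multiples k = scale q r (s (k * q)) c₁ (k * q) (≤-trans
    (*-monoʳ-≤ r (proj₂ (isSat (k * q)) (blockGraph k)
      ((λ h → let i , copy = unfold (Adj (blockGraph k)) h in block-free k i copy) , λ u v ne na → fold (AddEdge (blockGraph k) u v) (block-saturated k u v ne na))))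
    (block-copies k))

  after-multiples : ∀ k → (16 * (q * c₁) + 2) * suc (k * q) ≤ 16 * (q * r) * s (suc (k * q)) + 18 * (q * c₁) * c
  after-multiples k = go (proj₁ (isSat (suc (k * q))))
    where
    go : (Σ (SimpleGraph (suc (k * q))) λ G → Saturated F G × copiesK G r ≡ s (suc (k * q))) →
         (16 * (q * c₁) + 2) * suc (k * q) ≤ 16 * (q * r) * s (suc (k * q)) + 18 * (q * c₁) * c
    go (G , (free , sat) , e) = subst (λ N → (16 * (q * c₁) + 2) * suc (k * q) ≤ 16 * (q * r) * N + 18 * (q * c₁) * c) e
      (lower-bound G free′ sat′ shift (C-positive p r′) (proj₂ (uncovered-exists G free′ sat′ k (+-comm 1 (k * q)))))
      where
      free′ : FreeOf (Adj G)
      free′ i copy = free (fold (Adj G) (i , copy))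
      sat′ : ∀ u v → u ≢ v → ¬ Adj G u v → ∃ λ i → CopyIn (chain (sizes i)) (AddEdge G u v)
      sat′ u v ne na = unfold (AddEdge G u v) (sat u v ne na)

  diverges : ¬ Cauchy (ratio s)
  diverges = gap⇒¬Cauchy s q (16 * (q * c₁)) (16 * (q * r)) (18 * (q * c₁) * c) (s≤s z≤n) (s≤s z≤n) at-multiples after-multiples

r≤p : ∀ r′ p → 2 ≤ r′ → 3 * (r′ * r′) ≤ suc p → suc r′ ≤ p
r≤p r′@(suc _) p 2≤r′ big = s≤s⁻¹ (begin
  suc (suc r′)            ≡⟨ +-comm 2 r′ ⟩
  r′ + 2                  ≤⟨ +-mono-≤ (m≤m*n r′ r′) (*-mono-≤ {1} {2} {2} {r′} (s≤s z≤n) 2≤r′) ⟩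
  r′ * r′ + 2 * r′        ≤⟨ +-monoʳ-≤ (r′ * r′) (*-monoʳ-≤ 2 (m≤m*n r′ r′)) ⟩
  3 * (r′ * r′)           ≤⟨ big ⟩
  suc p                   ∎)
  where open ≤-Reasoning

theorem1p9 : ∀ (r : ℕ) → 3 ≤ r →
    Σ (ℕ → Family3) λ 𝓕 →
    (∀ i j → i ≢ j → ¬ SameFamily (𝓕 i) (𝓕 j)) ×
    (∀ i → Σ (ℕ → ℕ) λ s →
    (∀ n → IsSat (𝓕 i) r n (s n)) × ¬ Cauchy (ratio s))
theorem1p9 (suc (suc (suc t))) (s≤s (s≤s (s≤s z≤n))) =
  𝓕 ,
  (λ i j i≢j same → i≢j (+-cancelˡ-≡ M i j (Distinct.sameFamily⇒≡ r″ {M + i} {M + j} same))) ,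
  λ i → (λ n → proj₁ (value i n)) , (λ n → proj₂ (value i n)) ,
    Divergence.diverges (suc r″) (suc (M + i)) (s≤s (s≤s z≤n)) (r≤p (suc r″) (suc (M + i)) (s≤s (s≤s z≤n)) (big i))
      (C-shift (suc (M + i)) r″ (s≤s (s≤s z≤n)) (big i)) (𝓕 i) (λ _ h → h) (λ _ h → h) (λ n → proj₁ (value i n)) (λ n → proj₂ (value i n))
  where
  r″ M : ℕ
  r″ = suc t
  -- This is the threshold 3 (r - 1)² of `C-shift`; starting the parameters at M makes every member
  -- of the sequence of families admissible.
  M = 3 * (suc r″ * suc r″)
  big : ∀ i → M ≤ suc (suc (M + i))
  big i = ≤-trans (m≤m+n M i) (m≤n+m (M + i) 2)
  𝓕 : ℕ → Family3
  𝓕 i = Distinct.family r″ (M + i)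
  value : ∀ i n → ∃ λ s → IsSat (𝓕 i) (suc (suc r″)) n s
  value i = sat-exists (𝓕 i) (λ (j , copy) → Blocks.edgeless-free (suc r″) (suc (M + i)) j copy) (suc (suc r″))
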